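{- Let $G$ be a connected $K_4$-minor-free graph with $|V(G)|\ge 2$, let $\mathcal{F}$ be the set of all nontrivial 2-cuts of $G$, and for $v\in V(G)$ let $\mathcal{F}(v)=\{F\in\mathcal{F} : v\in F\}$. Suppose there is an integer $f(v)\ge 2$ for each $v\in V(G)$ and a nonnegative integer function $\omega$ on ordered pairs $(F,u)$ with $F\in\mathcal{F}$ and $u\in F$ such that $$\omega(F,u)+\omega(F,v)=c(G,F)-2\quad\text{for all } F=\{u,v\}\in\mathcal{F},$$ $$\sum_{F\in\mathcal{F}(u)}\omega(F,u)+c(G-u)-1\le f(u)-2\quad\text{for all } u\in V(G).$$ Choose a root edge $r_0s_0\in E(G)$ such that $c(G,r_0s_0)\le 1$. Let the blocks of $G$ be $B_0,B_1,\dots,B_k$, where $r_0s_0\in E(B_0)$. For each $i=1,\dots,k$, let $r_i$ be the root vertex of $B_i$, and choose $r_is_i\in E(B_i)$ with $c(G,r_is_i)\le 1$. Then $G$ has a spanning tree $T$ such that $d_T(v)\le f(v)$ for all $v\in V(G)$ and $d_T(v)\le f(v)-1$ for all $v\in\{r_0\}\cup\{s_0,s_1,\dots,s_k\}$. Furthermore, for $0\le i\le k$, $r_is_i\in E(T)$ if $c(G,r_is_i)=0$, and $r_is_i\notin E(T)$ if $c(G,r_is_i)=1$.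
   Context: All graphs are simple and finite; $c(H)$ is the number of components of $H$ and $G-u$ is $G$ with vertex $u$ deleted. For $S\subseteq V(G)$, an $S$-bridge is either an edge joining two vertices of $S$ (trivial bridge) or a component of $G-S$ together with all edges joining it to $S$ (nontrivial bridge). For a set $F=\{u,v\}$ of two vertices (not necessarily adjacent), $c(G,F)=c(G,uv)$ denotes the number of nontrivial $F$-bridges of $G$ that contain both $u$ and $v$. A nontrivial 2-cut of $G$ is a set $F$ of two vertices with $c(G,F)\ge 3$. A block is a connected graph with no cutvertex; a block of $G$ is a maximal connected subgraph of $G$ that is a block. The block-cutvertex tree of $G$ has as vertices the blocks and cutvertices, with a cutvertex adjacent to each block containing it; the block $B_0$ containing the root edge is the root of this tree, and the root vertex of a block $B_i\ne B_0$ is its parent cutvertex in the rooted block-cutvertex tree. A graph is $K_4$-minor-free if no graph isomorphic to $K_4$ can be obtained from it by edge contractions, edge deletions and vertex deletions. -}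

module Defs where

open import Data.Nat using (ℕ; zero; suc; _+_; _≤_; _<_; _<ᵇ_; _≤ᵇ_)
open import Data.Bool using (Bool; true; false; _∧_; _∨_; not; if_then_else_)
open import Data.Fin using (Fin; toℕ; _≟_; splitAt; _↑ˡ_; _↑ʳ_; inject₁; fromℕ)
import Data.Fin as Fin
open import Data.Maybe using (Maybe; just; nothing)
open import Data.Sum using (_⊎_; inj₁; inj₂)
open import Data.Product using (Σ; ∃; _×_; _,_)
open import Data.List using (List; allFin; foldr)
open import Data.Bool.ListAction using (any)
open import Relation.Nullary using (¬_)
open import Relation.Nullary.Decidable using (isYes)
open import Relation.Binary.PropositionalEquality using (_≡_; _≢_)
open import Function.Definitions using (Injective)

Adj : ℕ → Set
Adj n = Fin n → Fin n → Bool

record Simple {n : ℕ} (G : Adj n) : Set where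
  field
    adj-sym    : ∀ x y → G x y ≡ G y x
    adj-irrefl : ∀ x → G x x ≡ false

VSet : ℕ → Set
VSet n = Fin n → Bool

_==_ : ∀ {n} → Fin n → Fin n → Bool
x == y = isYes (x ≟ y)

allV : ∀ {n} → VSet n
allV _ = true

_∖_ : ∀ {n} → VSet n → Fin n → VSet n
(S ∖ u) w = S w ∧ not (w == u)

countV : ∀ {n} → (Fin n → Bool) → ℕ
countV {n} p = foldr (λ x acc → if p x then suc acc else acc) 0 (allFin n)

anyV : ∀ {n} → (Fin n → Bool) → Bool
anyV {n} p = any p (allFin n)

reach : ∀ {n} → Adj n → VSet n → ℕ → Fin n → Fin n → Bool
reach G S zero    x y = S x ∧ S y ∧ (x == y)
reach G S (suc j) x y =
  reach G S j x y ∨ anyV (λ z → reach G S j x z ∧ G z y ∧ S y)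

-- x and y lie in the same component of G[S] (walks of length ≤ n suffice)
conn : ∀ {n} → Adj n → VSet n → Fin n → Fin n → Bool
conn {n} G S x y = reach G S n x y

isRep : ∀ {n} → Adj n → VSet n → Fin n → Bool
isRep G S v = S v ∧ not (anyV (λ w → (toℕ w <ᵇ toℕ v) ∧ conn G S w v))

ncomp : ∀ {n} → Adj n → VSet n → ℕ
ncomp G S = countV (isRep G S)

ConnectedOn : ∀ {n} → Adj n → VSet n → Set
ConnectedOn G S = ncomp G S ≡ 1

Connected : ∀ {n} → Adj n → Set
Connected G = ConnectedOn G allV

-- c(G,F) for F = {u,v}: the number of nontrivial F-bridges containing
-- both u and v, i.e. the number of components C of G - {u,v} such that
-- some vertex of C is adjacent to u and some vertex of C is adjacent to v.

cF : ∀ {n} → Adj n → Fin n → Fin n → ℕ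
cF G u v = countV (λ w → isRep G S w ∧ touches w u ∧ touches w v)
  where
  S = (allV ∖ u) ∖ v
  touches : _ → _ → Bool
  touches w t = anyV (λ x → conn G S w x ∧ G x t)

NontrivialTwoCut : ∀ {n} → Adj n → Fin n → Fin n → Set
NontrivialTwoCut G u v = u ≢ v × 3 ≤ cF G u v

isNontrivialTwoCut : ∀ {n} → Adj n → Fin n → Fin n → Bool
isNontrivialTwoCut G u v = not (u == v) ∧ (3 ≤ᵇ cF G u v)

-- ω is encoded as ω u v = ω({u,v}, u).
-- Σ_{F ∈ 𝓕(u)} ω(F,u): each F ∈ 𝓕(u) is {u,v} for exactly one v.
sumω : ∀ {n} → Adj n → (Fin n → Fin n → ℕ) → Fin n → ℕ
sumω {n} G ω u =
  foldr (λ v acc → (if isNontrivialTwoCut G u v then ω u v else 0) + acc)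
        0 (allFin n)

inBranch : ∀ {n} → (Fin n → Maybe (Fin 4)) → Fin 4 → VSet n
inBranch β i v with β v
... | just j  = i == j
... | nothing = false

HasK4Minor : ∀ {n} → Adj n → Set
HasK4Minor {n} G =
  Σ (Fin n → Maybe (Fin 4)) λ β →
    (∀ i → ConnectedOn G (inBranch β i)) ×
    (∀ i j → i ≢ j → Σ (Fin n) λ x → Σ (Fin n) λ y →
        β x ≡ just i × β y ≡ just j × G x y ≡ true)

K4MinorFree : ∀ {n} → Adj n → Set
K4MinorFree G = ¬ HasK4Minor G

isCutvertexOn : ∀ {n} → Adj n → VSet n → Fin n → Bool
isCutvertexOn G S x = S x ∧ (ncomp G S <ᵇ ncomp G (S ∖ x))

IsBlockGraph : ∀ {n} → Adj n → VSet n → Set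
IsBlockGraph G S = ConnectedOn G S × (∀ x → isCutvertexOn G S x ≡ false)

-- S is (the vertex set of) a block of G: maximal with G[S] a block.
-- (Blocks of a graph are induced subgraphs, so they are determined by
-- their vertex sets.)
IsBlock : ∀ {n} → Adj n → VSet n → Set
IsBlock {n} G S =
  IsBlockGraph G S ×
  (∀ (S' : VSet n) → (∀ x → S x ≡ true → S' x ≡ true) →
     IsBlockGraph G S' → ∀ x → S' x ≡ S x)

IsBlockEnumeration : ∀ {n k} → Adj n → (Fin (suc k) → VSet n) → Set
IsBlockEnumeration {n} G B =
  (∀ i → IsBlock G (B i)) ×
  (∀ i j → (∀ x → B i x ≡ B j x) → i ≡ j) ×
  (∀ (S : VSet n) → IsBlock G S → Σ _ λ i → ∀ x → B i x ≡ S x)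

-- The block-cutvertex tree, as a graph on Fin (suc k + n): node (i ↑ˡ n)
-- is block B i and node (suc k ↑ʳ x) is vertex x (only cutvertices get
-- edges; other vertices are isolated nodes, outside the tree).
bcTree : ∀ {n k} → Adj n → (Fin (suc k) → VSet n) → Adj (suc k + n)
bcTree {n} {k} G B a b with splitAt (suc k) a | splitAt (suc k) b
... | inj₁ i | inj₂ x = B i x ∧ isCutvertexOn G allV x
... | inj₂ x | inj₁ i = B i x ∧ isCutvertexOn G allV x
... | _      | _      = false

blockNode : ∀ {n k} → Fin (suc k) → Fin (suc k + n)
blockNode {n} i = i ↑ˡ n

vertexNode : ∀ {n k} → Fin n → Fin (suc k + n)
vertexNode {n} {k} x = suc k ↑ʳ x

-- x is the root vertex of B i, i.e. the parent of B i in the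
-- block-cutvertex tree rooted at B₀ = B zero: x is a neighbour of B i
-- in the tree lying on the path from B i to B₀ (removing it separates
-- B i from B₀ in the tree).
IsRootVertex : ∀ {n k} → Adj n → (Fin (suc k) → VSet n) → Fin (suc k) → Fin n → Set
IsRootVertex {n} {k} G B i x =
  bcTree G B (blockNode {n} {k} i) (vertexNode {n} {k} x) ≡ true ×
  conn (bcTree G B) (allV ∖ vertexNode {n} {k} x)
       (blockNode {n} {k} i) (blockNode {n} {k} Fin.zero) ≡ false

deg : ∀ {n} → Adj n → Fin n → ℕ
deg T v = countV (T v)

HasCycle : ∀ {n} → Adj n → Set
HasCycle {n} T =
  Σ ℕ λ m → 2 ≤ m × Σ (Fin (suc m) → Fin n) λ c → Injective _≡_ _≡_ c ×
    (∀ (i : Fin m) → T (c (inject₁ i)) (c (Fin.suc i)) ≡ true) ×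
    T (c (fromℕ m)) (c Fin.zero) ≡ true

IsSpanningTree : ∀ {n} → Adj n → Adj n → Set
IsSpanningTree G T =
  Simple T × (∀ x y → T x y ≡ true → G x y ≡ true) ×
  Connected T × ¬ HasCycle T

module Submission where

-- It suffices to build a connected spanning subgraph with the required degrees that avoids r i s i when
-- c(G, r i s i) = 1: pruning it to a tree only lowers degrees, and an edge r i s i with c(G, r i s i) = 0
-- is a bridge of G, hence in every spanning tree.
--
-- The vertices behind a (those cut off by a from r₀) fall into components X of G - a. The edge a s i of
-- the block of X ∪ {a} at a splits X into s i, the vertices behind s i, and at most one component of
-- G - {a, s i} meeting both a and s i. Such a component X of G - {u,v}, with r₀ outside, contains by
-- K₄-minor-freeness a vertex a separating u from v in X; this splits X into a, the vertices behind a, and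
-- the components of G - {u,a} and of G - {a,v} in X meeting both terminals. With p such components for
-- {u,a}, one stays connected and each of the p - 1 others is solved with one unit of degree less at u or
-- at a. As c(G, ua) ≥ p + 1, the values ω({u,a},u) and ω({u,a},a) decide how often each happens.
--
-- Degrees at a terminal t are measured against the sum of ω({t,x},t) over x in the piece, which is
-- additive in the piece.

-- The recursion closes because of an exact account at each separating vertex a ≠ r₀. The hypothesis
-- says f(a) ≥ Σω + c(G - a) + 1, and the component of r₀ in G - a is not behind a. So after one
-- unit for each component behind a, two units remain besides Σω. In a piece with terminals u and v,
-- the two sides of a take one unit each. In a component behind w, one unit pays for the link to w
-- and the other is the slack required at s i.
--
-- Towards a terminal t, the bound c(G, ta) ≥ p + 1 comes from the component of G - {t,a} that holds
-- the other terminal: it meets a inside X and t by way of r₀. Hence ω({t,a},t) + ω({t,a},a) ≥ p - 1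
-- as soon as p ≥ 2, which pays for the p - 1 components that do not link; the one that links costs
-- a further unit at both ends. If t and a need not be linked, that component too costs only one
-- unit, which can be placed at a, so t is spared. A piece therefore needs two solutions: linked
-- with one unit at each terminal, and unlinked with a unit at only one terminal, of either choice.
-- The second is again linked on one side of a and unlinked on the other.

open import Defs
open import Data.Nat using (ℕ; zero; suc; _+_; _≤_; _<_; _<ᵇ_; z≤n; s≤s; s≤s⁻¹; _≤?_)
import Data.Nat.Properties as ℕₚ
open import Algebra.Properties.CommutativeSemigroup ℕₚ.+-commutativeSemigroup using (interchange)
open import Data.Nat.Tactic.RingSolver using (solve-∀)
open import Data.Bool using (Bool; true; false; _∧_; _∨_; not; if_then_else_)
import Data.Bool.Properties as Boolₚ
open import Data.Bool.ListAction using (any)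
open import Data.Fin using (Fin; zero; toℕ; _≟_; inject₁; fromℕ; splitAt)
import Data.Fin as Fin
import Data.Fin.Properties as Finₚ
open import Data.Maybe using (Maybe; just; nothing)
open import Data.Sum using (_⊎_; inj₁; inj₂; [_,_]′)
import Data.Sum as Sum
open import Function.Bundles using (Equivalence)
open import Data.Product using (Σ; ∃; _×_; _,_; proj₁; proj₂)
open import Data.Empty using (⊥)
open import Data.Unit using (⊤; tt)
open import Data.List using (List; length; []; _∷_; allFin; foldr; cartesianProduct)
import Data.List.Properties as Listₚ
open import Data.List.Relation.Unary.Any using (here; there)
import Data.List.Membership.Propositional as List
open import Data.List.Membership.Propositional.Properties using (∈-allFin; ∈-cartesianProduct⁺)
import Data.List.Relation.Unary.All as All
open import Data.List.Relation.Unary.AllPairs using ([]; _∷_)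
open import Data.List.Relation.Unary.Unique.Propositional using (Unique)
open import Data.List.Relation.Unary.Unique.Propositional.Properties using (allFin⁺)
open import Function using (_∘_; id; case_of_)
open import Relation.Nullary using (¬_; Dec; yes; no; contradiction)
open import Relation.Nullary.Decidable using (isYes; ¬?; map′; _→-dec_; _×-dec_; _⊎-dec_; decidable-stable)
open import Relation.Binary.PropositionalEquality using (_≡_; _≢_; refl; sym; trans; cong; cong₂; subst; subst₂; module ≡-Reasoning)
open import Relation.Binary using (tri<; tri≈; tri>)

-- Vertex sets

infix 4 _∈_ _∉_

-- A record rather than an abbreviation for S x ≡ true, so that x and S can be inferred.
record _∈_ {n} (x : Fin n) (S : VSet n) : Set where
  constructor mem
  field holds : S x ≡ true

open _∈_

_∉_ : ∀ {n} → Fin n → VSet n → Set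
x ∉ S = ¬ x ∈ S

_∈?_ : ∀ {n} (x : Fin n) (S : VSet n) → Dec (x ∈ S)
x ∈? S = map′ mem holds (S x Boolₚ.≟ true)

false⇒∉ : ∀ {n} {x : Fin n} {S : VSet n} → S x ≡ false → x ∉ S
false⇒∉ eq (mem h) with () ← trans (sym h) eq

∉⇒false : ∀ {n} {x : Fin n} {S : VSet n} → x ∉ S → S x ≡ false
∉⇒false x∉S = Boolₚ.¬-not (x∉S ∘ mem)

∧⁻ : ∀ {a b} → a ∧ b ≡ true → a ≡ true × b ≡ true
∧⁻ {true} {true} _ = refl , refl

∧⁺ : ∀ {a b} → a ≡ true → b ≡ true → a ∧ b ≡ true
∧⁺ refl refl = refl

∨⁻ : ∀ {a b} → a ∨ b ≡ true → a ≡ true ⊎ b ≡ true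
∨⁻ {true}  _ = inj₁ refl
∨⁻ {false} p = inj₂ p

∨⁺ˡ : ∀ {a b} → a ≡ true → a ∨ b ≡ true
∨⁺ˡ refl = refl

∨⁺ʳ : ∀ {a b} → b ≡ true → a ∨ b ≡ true
∨⁺ʳ {a} refl = Boolₚ.∨-zeroʳ a

not⁺ : ∀ {a} → ¬ a ≡ true → not a ≡ true
not⁺ p = cong not (Boolₚ.¬-not p)

not⁻ : ∀ {a} → not a ≡ true → ¬ a ≡ true
not⁻ {false} _ ()

isYes⁺ : ∀ {P : Set} (d : Dec P) → P → isYes d ≡ true
isYes⁺ (yes _) _ = refl
isYes⁺ (no ¬p) p = contradiction p ¬p

isYes⁻ : ∀ {P : Set} (d : Dec P) → isYes d ≡ true → P
isYes⁻ (yes p) _ = p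

==-refl : ∀ {n} (x : Fin n) → (x == x) ≡ true
==-refl x = isYes⁺ (x ≟ x) refl

∖⁺ : ∀ {n} {S : VSet n} {u x} → x ∈ S → x ≢ u → x ∈ (S ∖ u)
∖⁺ {u = u} {x} (mem xS) x≢u = mem (∧⁺ xS (not⁺ (x≢u ∘ isYes⁻ (x ≟ u))))

∖⁻ : ∀ {n} {S : VSet n} {u x} → x ∈ (S ∖ u) → x ∈ S × x ≢ u
∖⁻ {S = S} {u} {x} (mem p) =
  mem (proj₁ (∧⁻ {S x} p)) , λ { refl → not⁻ (proj₂ (∧⁻ {S x} p)) (==-refl x) }

∖⊆ : ∀ {n} {S : VSet n} {u x} → x ∈ (S ∖ u) → x ∈ S
∖⊆ = proj₁ ∘ ∖⁻

u∉∖u : ∀ {n} {S : VSet n} {u} → u ∉ (S ∖ u)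
u∉∖u p = proj₂ (∖⁻ p) refl

_⊆_ : ∀ {n} → VSet n → VSet n → Set
S ⊆ S′ = ∀ {x} → x ∈ S → x ∈ S′

∅ : ∀ {n} → VSet n
∅ _ = false

∈allV : ∀ {n} {x : Fin n} → x ∈ allV
∈allV = mem refl

opaque

  infixr 7 _∩_
  infixr 6 _∪_

  _∩_ _∪_ : ∀ {n} → VSet n → VSet n → VSet n
  (S ∩ S′) x = S x ∧ S′ x
  (S ∪ S′) x = S x ∨ S′ x

  ∁ : ∀ {n} → VSet n → VSet n
  ∁ S x = not (S x)

  ⁅_⁆ : ∀ {n} → Fin n → VSet n
  ⁅ a ⁆ x = x == a

  ∩⁺ : ∀ {n} {S S′ : VSet n} {x} → x ∈ S → x ∈ S′ → x ∈ S ∩ S′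
  ∩⁺ (mem p) (mem q) = mem (∧⁺ p q)

  ∩⁻ : ∀ {n} {S S′ : VSet n} {x} → x ∈ S ∩ S′ → x ∈ S × x ∈ S′
  ∩⁻ (mem h) = let p , q = ∧⁻ h in mem p , mem q

  ∪⁺ˡ : ∀ {n} {S S′ : VSet n} {x} → x ∈ S → x ∈ S ∪ S′
  ∪⁺ˡ (mem p) = mem (∨⁺ˡ p)

  ∪⁺ʳ : ∀ {n} {S S′ : VSet n} {x} → x ∈ S′ → x ∈ S ∪ S′
  ∪⁺ʳ {S = S} {x = x} (mem p) = mem (∨⁺ʳ {S x} p)

  ∪⁻ : ∀ {n} {S S′ : VSet n} {x} → x ∈ S ∪ S′ → x ∈ S ⊎ x ∈ S′
  ∪⁻ (mem h) = Sum.map mem mem (∨⁻ h)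

  ∁⁺ : ∀ {n} {S : VSet n} {x} → x ∉ S → x ∈ ∁ S
  ∁⁺ x∉S = mem (not⁺ (x∉S ∘ mem))

  ∁⁻ : ∀ {n} {S : VSet n} {x} → x ∈ ∁ S → x ∉ S
  ∁⁻ (mem h) (mem p) = not⁻ h p

  ⁅⁆⁺ : ∀ {n} {x : Fin n} → x ∈ ⁅ x ⁆
  ⁅⁆⁺ {x = x} = mem (==-refl x)

  ⁅⁆⁻ : ∀ {n} {x a : Fin n} → x ∈ ⁅ a ⁆ → x ≡ a
  ⁅⁆⁻ {x = x} {a} (mem h) = isYes⁻ (x ≟ a) h

Disjoint : ∀ {n} → VSet n → VSet n → Set
Disjoint S S′ = ∀ {x} → x ∈ S → x ∉ S′

-- Counting and summing over the vertices

count : ∀ {n} → VSet n → List (Fin n) → ℕ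
count p = foldr (λ x acc → if p x then suc acc else acc) 0

sumL : ∀ {n} → (Fin n → ℕ) → List (Fin n) → ℕ
sumL g = foldr (λ x acc → g x + acc) 0

module _ {n : ℕ} where

  count-mono : {p q : VSet n} → p ⊆ q → ∀ l → count p l ≤ count q l
  count-mono p⊆q []      = z≤n
  count-mono {p} {q} p⊆q (x ∷ l) with p x in px | q x in qx
  ... | true  | true  = s≤s (count-mono p⊆q l)
  ... | true  | false = contradiction (p⊆q (mem px)) (false⇒∉ qx)
  ... | false | true  = ℕₚ.m≤n⇒m≤1+n (count-mono p⊆q l)
  ... | false | false = count-mono p⊆q l

  count-mono-< : {p q : VSet n} → p ⊆ q → ∀ {x} → x ∉ p → x ∈ q →
                 ∀ {l} → x List.∈ l → count p l < count q l
  count-mono-< {p} {q} p⊆q x∉p x∈q {y ∷ l} (here refl) with p y in py | q y in qy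
  ... | true  | _     = contradiction (mem py) x∉p
  ... | false | true  = s≤s (count-mono p⊆q l)
  ... | false | false = contradiction x∈q (false⇒∉ qy)
  count-mono-< {p} {q} p⊆q x∉p x∈q {y ∷ l} (there x∈l) with p y in py | q y in qy
  ... | true  | true  = s≤s (count-mono-< p⊆q x∉p x∈q x∈l)
  ... | true  | false = contradiction (p⊆q (mem py)) (false⇒∉ qy)
  ... | false | true  = ℕₚ.m<n⇒m<1+n (count-mono-< p⊆q x∉p x∈q x∈l)
  ... | false | false = count-mono-< p⊆q x∉p x∈q x∈l

  opaque
    unfolding _∪_

    count-∪ : (p q : VSet n) → ∀ l → count (p ∪ q) l ≤ count p l + count q l
    count-∪ p q []      = z≤n
    count-∪ p q (x ∷ l) with p x | q x
    ... | true  | true  = s≤s (ℕₚ.≤-trans (count-∪ p q l) (ℕₚ.+-monoʳ-≤ _ (ℕₚ.n≤1+n _)))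
    ... | true  | false = s≤s (count-∪ p q l)
    ... | false | true  = ℕₚ.≤-trans (s≤s (count-∪ p q l)) (ℕₚ.≤-reflexive (sym (ℕₚ.+-suc _ _)))
    ... | false | false = count-∪ p q l

  count-none : {p : VSet n} → ∀ l → (∀ {x} → x List.∈ l → x ∉ p) → count p l ≡ 0
  count-none         []      h = refl
  count-none {p} (x ∷ l) h with p x in px
  ... | true  = contradiction (mem px) (h (here refl))
  ... | false = count-none l (h ∘ there)

  opaque
    unfolding ⁅_⁆

    count-⁅⁆ : ∀ (a : Fin n) {l} → Unique l → count ⁅ a ⁆ l ≤ 1
    count-⁅⁆ a {[]}    _ = z≤n
    count-⁅⁆ a {x ∷ l} (x∉l ∷ ul) with x ≟ a
    ... | yes refl = s≤s (ℕₚ.≤-reflexive (count-none {⁅ a ⁆} l λ {y} y∈l y≡a →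
                       All.lookup x∉l y∈l (sym (⁅⁆⁻ y≡a))))
    ... | no _     = count-⁅⁆ a ul

  countV-mono : {p q : VSet n} → p ⊆ q → countV p ≤ countV q
  countV-mono p⊆q = count-mono p⊆q (allFin n)

  countV-mono-< : {p q : VSet n} → p ⊆ q → ∀ {x} → x ∉ p → x ∈ q → countV p < countV q
  countV-mono-< p⊆q {x} x∉p x∈q = count-mono-< p⊆q x∉p x∈q (∈-allFin x)

  countV-∪ : (p q : VSet n) → countV (p ∪ q) ≤ countV p + countV q
  countV-∪ p q = count-∪ p q (allFin n)

  countV-none : {p : VSet n} → (∀ x → x ∉ p) → countV p ≡ 0
  countV-none h = count-none (allFin n) λ {x} _ → h x

  countV-⁅⁆ : ∀ a → countV {n} ⁅ a ⁆ ≤ 1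
  countV-⁅⁆ a = count-⁅⁆ a (allFin⁺ n)

  countV-∖ : {S : VSet n} → ∀ {x} → x ∈ S → countV (S ∖ x) < countV S
  countV-∖ xS = countV-mono-< ∖⊆ u∉∖u xS

  countV-⊂ : {Y X : VSet n} → ∀ {a m} → Y ⊆ X → a ∉ Y → a ∈ X → countV X ≤ suc m → countV Y ≤ m
  countV-⊂ Y⊆X a∉Y a∈X X≤ = s≤s⁻¹ (ℕₚ.≤-trans (countV-mono-< Y⊆X a∉Y a∈X) X≤)

  countV-some : {p : VSet n} → ∀ {x} → x ∈ p → 1 ≤ countV p
  countV-some xp = ℕₚ.≤-trans (s≤s z≤n) (countV-∖ xp)

  countV≤1 : {p : VSet n} → (∀ {x y} → x ∈ p → y ∈ p → x ≡ y) → countV p ≤ 1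
  countV≤1 {p} h with Finₚ.any? (_∈? p)
  ... | yes (x , xp) = ℕₚ.≤-trans (countV-mono λ {y} yp → subst (_∈ ⁅ x ⁆) (h xp yp) ⁅⁆⁺) (countV-⁅⁆ x)
  ... | no ¬p        = ℕₚ.≤-trans (ℕₚ.≤-reflexive (countV-none λ x xp → ¬p (x , xp))) z≤n

  countV≤1⇒≡ : {p : VSet n} → countV p ≤ 1 → ∀ {x y} → x ∈ p → y ∈ p → x ≡ y
  countV≤1⇒≡ {p} c {x} {y} xp yp with x ≟ y
  ... | yes x≡y = x≡y
  ... | no x≢y  = contradiction (ℕₚ.≤-trans
                    (s≤s (countV-some (∖⁺ yp (x≢y ∘ sym)))) (countV-∖ xp)) (ℕₚ.<⇒≱ (s≤s c))

  countV≤n : (p : VSet n) → countV p ≤ n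
  countV≤n p = ℕₚ.≤-trans (go (allFin n)) (ℕₚ.≤-reflexive (Listₚ.length-tabulate {n = n} id))
    where
    go : ∀ l → count p l ≤ length l
    go []      = z≤n
    go (x ∷ l) with p x
    ... | true  = s≤s (go l)
    ... | false = ℕₚ.m≤n⇒m≤1+n (go l)

  sumL-mono : {g h : Fin n → ℕ} → (∀ x → g x ≤ h x) → ∀ l → sumL g l ≤ sumL h l
  sumL-mono g≤h []      = z≤n
  sumL-mono g≤h (x ∷ l) = ℕₚ.+-mono-≤ (g≤h x) (sumL-mono g≤h l)

  sumL-+ : {g g′ h : Fin n → ℕ} → (∀ x → g x + g′ x ≤ h x) → ∀ l → sumL g l + sumL g′ l ≤ sumL h l
  sumL-+ le []      = z≤n
  sumL-+ {g} {g′} le (x ∷ l) =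
    ℕₚ.≤-trans (ℕₚ.≤-reflexive (interchange (g x) (sumL g l) (g′ x) (sumL g′ l)))
               (ℕₚ.+-mono-≤ (le x) (sumL-+ le l))

  ∈⇒≤sumL : (g : Fin n → ℕ) → ∀ {x l} → x List.∈ l → g x ≤ sumL g l
  ∈⇒≤sumL g (here refl) = ℕₚ.m≤m+n _ _
  ∈⇒≤sumL g (there x∈l) = ℕₚ.≤-trans (∈⇒≤sumL g x∈l) (ℕₚ.m≤n+m _ _)

  anyV⁺ : {p : VSet n} → ∀ {x} → x ∈ p → anyV p ≡ true
  anyV⁺ {p} {x} (mem xp) = go (∈-allFin x)
    where
    go : ∀ {l} → x List.∈ l → any p l ≡ true
    go (here refl) = ∨⁺ˡ xp
    go {y ∷ _} (there x∈l) = ∨⁺ʳ {p y} (go x∈l)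

  anyV⁻ : {p : VSet n} → anyV p ≡ true → ∃ (_∈ p)
  anyV⁻ {p} = go (allFin n)
    where
    go : ∀ l → any p l ≡ true → ∃ (_∈ p)
    go (x ∷ l) h with p x in px
    ... | true  = x , mem px
    ... | false = go l h

-- Walks inside a vertex set

data Path {n} (G : Adj n) (S : VSet n) : Fin n → Fin n → Set where
  nil  : ∀ {x} → x ∈ S → Path G S x x
  cons : ∀ {x y z} → x ∈ S → G x y ≡ true → Path G S y z → Path G S x z

module _ {n} {G : Adj n} where

  source∈ : ∀ {S x y} → Path G S x y → x ∈ S
  source∈ (nil xS)        = xS
  source∈ (cons xS _ _) = xS

  target∈ : ∀ {S x y} → Path G S x y → y ∈ S
  target∈ (nil xS)       = xS
  target∈ (cons _ _ p) = target∈ p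

  infixr 5 _++_
  _++_ : ∀ {S x y z} → Path G S x y → Path G S y z → Path G S x z
  (nil _)        ++ q = q
  (cons xS e p) ++ q = cons xS e (p ++ q)

  edge : ∀ {S x y} → x ∈ S → y ∈ S → G x y ≡ true → Path G S x y
  edge xS yS e = cons xS e (nil yS)

  gmap : ∀ {G′ : Adj n} {S S′ x y} → (∀ {x y} → G x y ≡ true → G′ x y ≡ true) → S ⊆ S′ →
         Path G S x y → Path G′ S′ x y
  gmap g s (nil xS)       = nil (s xS)
  gmap g s (cons xS e p) = cons (s xS) (g e) (gmap g s p)

  widen : ∀ {S S′ x y} → S ⊆ S′ → Path G S x y → Path G S′ x y
  widen = gmap id

  -- Each vertex of a walk to `y` has itself a walk to `y`, so whatever follows from reaching `y`
  -- holds along the whole walk.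
  restrict : ∀ {S Q y} → (∀ {z} → Path G S z y → z ∈ Q) → ∀ {x} → Path G S x y → Path G Q x y
  restrict h p@(nil xS)       = nil (h p)
  restrict h p@(cons xS e p′) = cons (h p) e (restrict h p′)

  -- Cut a walk at its last visit to its starting vertex.
  last-visit : ∀ {S x y} → Path G S x y →
               x ≡ y ⊎ ∃ λ z → G x z ≡ true × Path G (S ∖ x) z y
  last-visit {S} {w} = [ (λ p → contradiction (source∈ p) u∉∖u) , id ]′ ∘ go
    where
    go : ∀ {x y} → Path G S x y →
         Path G (S ∖ w) x y ⊎ (w ≡ y ⊎ ∃ λ z → G w z ≡ true × Path G (S ∖ w) z y)
    go {x} (nil xS) with x ≟ w
    ... | yes refl = inj₂ (inj₁ refl)
    ... | no x≢w   = inj₁ (nil (∖⁺ xS x≢w))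
    go {x} (cons xS e p) with go p
    ... | inj₂ r = inj₂ r
    ... | inj₁ q with x ≟ w
    ...   | yes refl = inj₂ (inj₂ (_ , e , q))
    ...   | no x≢w   = inj₁ (cons (∖⁺ xS x≢w) e q)

  exit : ∀ {S x y} Q → Path G S x y → x ∈ Q → y ∉ Q →
         ∃ λ p → ∃ λ q → Path G (S ∩ Q) x p × G p q ≡ true × q ∈ S × q ∉ Q
  exit Q (nil xS) xQ y∉Q = contradiction xQ y∉Q
  exit {x = x} Q (cons {y = z} xS e p) xQ y∉Q with z ∈? Q
  ... | no z∉Q = x , z , nil (∩⁺ xS xQ) , e , source∈ p , z∉Q
  ... | yes zQ with exit Q p zQ y∉Q
  ...   | a , b , q , e′ , bS , b∉Q = a , b , cons (∩⁺ xS xQ) e q , e′ , bS , b∉Q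

-- `conn` decides the existence of walks.

module _ {n} {G : Adj n} where

  private
    reach-suc⁻ : ∀ {S} j {x y} → reach G S (suc j) x y ≡ true →
      reach G S j x y ≡ true ⊎ ∃ λ z → reach G S j x z ≡ true × G z y ≡ true × y ∈ S
    reach-suc⁻ {S} j {x} {y} r with ∨⁻ {reach G S j x y} r
    ... | inj₁ r′ = inj₁ r′
    ... | inj₂ r′ with anyV⁻ {p = λ z → reach G S j x z ∧ G z y ∧ S y} r′
    ...   | z , mem h with ∧⁻ {reach G S j x z} h
    ...     | rz , h′ with ∧⁻ {G z y} h′
    ...       | e , yS = inj₂ (z , rz , e , mem yS)

    reach-suc⁺ : ∀ {S} j {x y z} → reach G S j x z ≡ true → G z y ≡ true → y ∈ S →
      reach G S (suc j) x y ≡ true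
    reach-suc⁺ {S} j {x} {y} {z} rz e (mem yS) = ∨⁺ʳ {reach G S j x y}
      (anyV⁺ {p = λ z → reach G S j x z ∧ G z y ∧ S y} {z} (mem (∧⁺ rz (∧⁺ e yS))))

    reach-zero⁻ : ∀ {S x y} → reach G S 0 x y ≡ true → x ∈ S × x ≡ y
    reach-zero⁻ {S} {x} {y} r with ∧⁻ {S x} r
    ... | xS , r′ = mem xS , isYes⁻ (x ≟ y) (proj₂ (∧⁻ {S y} r′))

  reach⇒Path : ∀ {S} j {x y} → reach G S j x y ≡ true → Path G S x y
  reach⇒Path {S} zero r with reach-zero⁻ {S} r
  ... | xS , refl = nil xS
  reach⇒Path {S} (suc j) r with reach-suc⁻ {S} j r
  ... | inj₁ r′              = reach⇒Path j r′
  ... | inj₂ (z , rz , e , yS) = let p = reach⇒Path j rz in p ++ edge (target∈ p) yS e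

  private
    reach-≤ : ∀ {S i j x y} → i ≤ j → reach G S i x y ≡ true → reach G S j x y ≡ true
    reach-≤ {j = zero} z≤n r = r
    reach-≤ {S} {i} {suc j} i≤j r with ℕₚ.m≤n⇒m<n∨m≡n i≤j
    ... | inj₁ (s≤s i≤j′) = ∨⁺ˡ (reach-≤ {S} i≤j′ r)
    ... | inj₂ refl       = r

    reach-refl : ∀ {S x} → x ∈ S → ∀ j → reach G S j x x ≡ true
    reach-refl {S} {x} (mem xS) j = reach-≤ {S} {0} {j} z≤n (∧⁺ xS (∧⁺ xS (==-refl x)))

    reach-mono : ∀ {S S′} → S ⊆ S′ → ∀ j {x y} → reach G S j x y ≡ true → reach G S′ j x y ≡ true
    reach-mono {S} {S′} s zero r with reach-zero⁻ {S} r
    ... | xS , refl = reach-refl {S′} (s xS) 0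
    reach-mono {S} {S′} s (suc j) r with reach-suc⁻ {S} j r
    ... | inj₁ r′                = ∨⁺ˡ (reach-mono {S} {S′} s j r′)
    ... | inj₂ (z , rz , e , yS) = reach-suc⁺ {S′} j (reach-mono {S} {S′} s j rz) e (s yS)

    reach-cons : ∀ {S} j {x y z} → x ∈ S → G x y ≡ true → reach G S j y z ≡ true →
                 reach G S (suc j) x z ≡ true
    reach-cons {S} zero xS e r with reach-zero⁻ {S} r
    ... | yS , refl = reach-suc⁺ {S} 0 (reach-refl {S} xS 0) e yS
    reach-cons {S} (suc j) xS e r with reach-suc⁻ {S} j r
    ... | inj₁ r′                 = ∨⁺ˡ (reach-cons {S} j xS e r′)
    ... | inj₂ (w , rw , e′ , zS) = reach-suc⁺ {S} (suc j) (reach-cons {S} j xS e rw) e′ zS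

  -- After the last visit to its start a walk lives in a set with one vertex less. Hence n rounds
  -- suffice and `conn` finds every walk.
  Path⇒reach : ∀ m {S x y} → countV S ≤ m → Path G S x y → reach G S m x y ≡ true
  Path⇒reach zero c p = contradiction (ℕₚ.≤-trans (countV-some (source∈ p)) c) λ ()
  Path⇒reach (suc m) {S} {x} c p with last-visit p
  ... | inj₁ refl        = reach-refl {S} (source∈ p) (suc m)
  ... | inj₂ (z , e , q) = reach-cons {S} m (source∈ p) e
        (reach-mono {S ∖ x} {S} ∖⊆ m
          (Path⇒reach m (s≤s⁻¹ (ℕₚ.≤-trans (countV-∖ (source∈ p)) c)) q))

  conn⁻ : ∀ {S x y} → y ∈ conn G S x → Path G S x y
  conn⁻ (mem h) = reach⇒Path n h

  conn⁺ : ∀ {S x y} → Path G S x y → y ∈ conn G S x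
  conn⁺ {S} p = mem (Path⇒reach n (countV≤n S) p)

  opaque
    Path? : ∀ S x y → Dec (Path G S x y)
    Path? S x y = map′ conn⁻ conn⁺ (y ∈? conn G S x)

-- Components and their representatives

module Components {n} {G : Adj n} (G-sym : ∀ {x y} → G x y ≡ true → G y x ≡ true) where

  reverse : ∀ {S x y} → Path G S x y → Path G S y x
  reverse (nil xS)       = nil xS
  reverse (cons xS e p) = reverse p ++ edge (source∈ p) xS (G-sym e)

  module _ (S : VSet n) where

    private
      smaller : Fin n → VSet n
      smaller v w = (toℕ w <ᵇ toℕ v) ∧ conn G S w v

      smaller⁻ : ∀ {v w} → w ∈ smaller v → toℕ w < toℕ v × Path G S w v
      smaller⁻ {v} {w} (mem h) with ∧⁻ {toℕ w <ᵇ toℕ v} h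
      ... | w<v , c = ℕₚ.<ᵇ⇒< (toℕ w) (toℕ v) (Equivalence.from Boolₚ.T-≡ w<v) , conn⁻ (mem c)

    isRep⁻ : ∀ {v} → v ∈ isRep G S → v ∈ S × (∀ {w} → Path G S w v → ¬ toℕ w < toℕ v)
    isRep⁻ {v} (mem h) with ∧⁻ {S v} h
    ... | vS , min = mem vS , λ {w} p w<v → not⁻ min (anyV⁺ {p = smaller v} {w}
          (mem (∧⁺ (Equivalence.to Boolₚ.T-≡ (ℕₚ.<⇒<ᵇ w<v)) (holds (conn⁺ p)))))

    rep : ∀ {x} → x ∈ S → ∃ λ w → w ∈ isRep G S × Path G S w x
    rep {x} = go (suc (toℕ x)) ℕₚ.≤-refl
      where
      go : ∀ m {x} → toℕ x < m → x ∈ S → ∃ λ w → w ∈ isRep G S × Path G S w x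
      go (suc m) {x} (s≤s x≤m) xS with anyV (smaller x) in eq
      ... | false = x , mem (∧⁺ (holds xS) (cong not eq)) , nil xS
      ... | true with anyV⁻ {p = smaller x} eq
      ...   | w , w∈ with smaller⁻ w∈
      ...     | w<x , p with go m (ℕₚ.<-≤-trans w<x x≤m) (source∈ p)
      ...       | v , vr , q = v , vr , q ++ p

    rep-unique : ∀ {v w} → v ∈ isRep G S → w ∈ isRep G S → Path G S v w → v ≡ w
    rep-unique {v} {w} vr wr p with ℕₚ.<-cmp (toℕ v) (toℕ w)
    ... | tri< v<w _ _ = contradiction v<w (proj₂ (isRep⁻ wr) p)
    ... | tri≈ _ v≡w _ = Finₚ.toℕ-injective v≡w
    ... | tri> _ _ w<v = contradiction w<v (proj₂ (isRep⁻ vr) (reverse p))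

    ncomp≤1⇒Path : ncomp G S ≤ 1 → ∀ {x y} → x ∈ S → y ∈ S → Path G S x y
    ncomp≤1⇒Path c xS yS with rep xS | rep yS
    ... | v , vr , p | w , wr , q with countV≤1⇒≡ c vr wr
    ...   | refl = reverse p ++ q

    Path⇒ncomp≤1 : (∀ {x y} → x ∈ S → y ∈ S → Path G S x y) → ncomp G S ≤ 1
    Path⇒ncomp≤1 h = countV≤1 λ vr wr →
      rep-unique vr wr (h (proj₁ (isRep⁻ vr)) (proj₁ (isRep⁻ wr)))

    ncomp≥1 : ∀ {x} → x ∈ S → 1 ≤ ncomp G S
    ncomp≥1 xS = countV-some (proj₁ (proj₂ (rep xS)))

    Path⇒Connected : ∀ {x} → x ∈ S → (∀ {x y} → x ∈ S → y ∈ S → Path G S x y) → ConnectedOn G S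
    Path⇒Connected xS h = ℕₚ.≤-antisym (Path⇒ncomp≤1 h) (ncomp≥1 xS)

    Connected⇒Path : ConnectedOn G S → ∀ {x y} → x ∈ S → y ∈ S → Path G S x y
    Connected⇒Path c = ncomp≤1⇒Path (ℕₚ.≤-reflexive c)

    within-component : ∀ {w x y} → Path G S w x → Path G S x y → Path G (conn G S w) x y
    within-component {w} p q = restrict (λ r → conn⁺ (p ++ (q ++ reverse r))) q

    component-connected : ∀ {w x y} → x ∈ conn G S w → y ∈ conn G S w → Path G (conn G S w) x y
    component-connected x∈ y∈ = within-component (conn⁻ x∈) (reverse (conn⁻ x∈) ++ conn⁻ y∈)

    -- Iterates a construction for single components over all those with representative in `sel`.
    -- The index of `Q` counts the components merged so far; disjointness from the next one is what
    -- makes degrees add up.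
    fold-components : (Q : ℕ → VSet n → Set) (sel : VSet n) → sel ⊆ isRep G S → Q 0 ∅ →
      (∀ {p X w} → w ∈ sel → X ⊆ S → Disjoint X (conn G S w) → Q p X → Q (suc p) (X ∪ conn G S w)) →
      ∃ λ U → Q (countV sel) U × (∀ {x} → x ∈ U → ∃ λ w → w ∈ sel × Path G S w x) ×
              (∀ {w x} → w ∈ sel → Path G S w x → x ∈ U)
    fold-components Q sel sel⊆ q₀ q₊ with go (allFin n) (allFin⁺ n)
      where
      go : ∀ l → Unique l →
        ∃ λ U → Q (count sel l) U × (∀ {x} → x ∈ U → ∃ λ w → (w ∈ sel × w List.∈ l) × Path G S w x) ×
                (∀ {w x} → w ∈ sel → w List.∈ l → Path G S w x → x ∈ U)
      go []      _ = ∅ , q₀ , (λ ()) , λ _ ()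
      go (v ∷ l) (v∉l ∷ ul) with sel v in sv | go l ul
      ... | false | U , qU , from , to = U , qU ,
              (λ x∈U → let w , (ws , w∈l) , p = from x∈U in w , (ws , there w∈l) , p) ,
              λ { ws (here refl) p → contradiction ws (false⇒∉ sv) ; ws (there w∈l) p → to ws w∈l p }
      ... | true | U , qU , from , to =
              U ∪ conn G S v ,
              q₊ (mem sv) (λ x∈U → target∈ (proj₂ (proj₂ (from x∈U))))
                 (λ x∈U x∈C → let w , (ws , w∈l) , p = from x∈U in
                    All.lookup v∉l w∈l
                      (rep-unique (sel⊆ (mem sv)) (sel⊆ ws) (conn⁻ x∈C ++ reverse p))) qU ,
              (λ x∈ → [ (λ x∈U → let w , (ws , w∈l) , p = from x∈U in w , (ws , there w∈l) , p)
                      , (λ x∈C → v , (mem sv , here refl) , conn⁻ x∈C) ]′ (∪⁻ x∈)) ,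
              λ { ws (here refl) p → ∪⁺ʳ (conn⁺ p)
                ; ws (there w∈l) p → ∪⁺ˡ (to ws w∈l p) }
    ... | U , qU , from , to = U , qU ,
          (λ x∈U → let w , (ws , _) , p = from x∈U in w , ws , p) ,
          λ {w} ws p → to ws (∈-allFin w) p

  opaque
    -- Everything but r₀ if a ≡ r₀.
    behind : Fin n → Fin n → VSet n
    behind r₀ a = (allV ∖ a) ∩ ∁ (conn G (allV ∖ a) r₀)

    behind⁺ : ∀ {r₀ a x} → x ≢ a → ¬ Path G (allV ∖ a) r₀ x → x ∈ behind r₀ a
    behind⁺ x≢a np = ∩⁺ (∖⁺ ∈allV x≢a) (∁⁺ (np ∘ conn⁻))

    behind⁻ : ∀ {r₀ a x} → x ∈ behind r₀ a → x ≢ a × ¬ Path G (allV ∖ a) r₀ x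
    behind⁻ h = let h₁ , h₂ = ∩⁻ h in proj₂ (∖⁻ h₁) , ∁⁻ h₂ ∘ conn⁺

  behind? : ∀ r₀ {a x} → x ≢ a → x ∈ behind r₀ a ⊎ Path G (allV ∖ a) r₀ x
  behind? r₀ {a} {x} x≢a with Path? (allV ∖ a) r₀ x
  ... | yes p = inj₂ p
  ... | no np = inj₁ (behind⁺ x≢a np)

  -- Bridges of a pair of vertices

  opaque
    unfolding _∩_

    -- Repeats the local function of the same name in `cF`, so that `cF≡` holds by `refl`.
    touches : VSet n → Fin n → VSet n
    touches S t w = anyV (λ x → conn G S w x ∧ G x t)

    touches⁺ : ∀ {S w x t} → Path G S w x → G x t ≡ true → w ∈ touches S t
    touches⁺ {S} {w} {x} {t} p e =
      mem (anyV⁺ {p = λ x → conn G S w x ∧ G x t} {x} (mem (∧⁺ (holds (conn⁺ p)) e)))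

    touches⁻ : ∀ {S w t} → w ∈ touches S t → ∃ λ x → Path G S w x × G x t ≡ true
    touches⁻ {S} {w} {t} (mem h) with anyV⁻ {p = λ x → conn G S w x ∧ G x t} h
    ... | x , mem h′ with ∧⁻ {conn G S w x} h′
    ...   | c , e = x , conn⁻ (mem c) , e

    bridge : Fin n → Fin n → VSet n
    bridge u v = isRep G ((allV ∖ u) ∖ v) ∩ touches ((allV ∖ u) ∖ v) u ∩ touches ((allV ∖ u) ∖ v) v

    cF≡ : ∀ u v → cF G u v ≡ countV (bridge u v)
    cF≡ u v = refl

    bridge⁺ : ∀ {u v w} → w ∈ isRep G ((allV ∖ u) ∖ v) → w ∈ touches ((allV ∖ u) ∖ v) u →
              w ∈ touches ((allV ∖ u) ∖ v) v → w ∈ bridge u v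
    bridge⁺ r tu tv = ∩⁺ r (∩⁺ tu tv)

    bridge⁻ : ∀ {u v w} → w ∈ bridge u v → w ∈ isRep G ((allV ∖ u) ∖ v) ×
              w ∈ touches ((allV ∖ u) ∖ v) u × w ∈ touches ((allV ∖ u) ∖ v) v
    bridge⁻ h with ∩⁻ h
    ... | r , h′ = r , ∩⁻ h′

  find-bridge : ∀ {u v x y z} → Path G ((allV ∖ u) ∖ v) x y → G y u ≡ true →
                Path G ((allV ∖ u) ∖ v) x z → G z v ≡ true →
                ∃ λ w → w ∈ bridge u v × Path G ((allV ∖ u) ∖ v) w x
  find-bridge {u} {v} p e q e′ with rep _ (source∈ p)
  ... | w , wr , r = w , bridge⁺ wr (touches⁺ (r ++ p) e) (touches⁺ (r ++ q) e′) , r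

  cF-sym : ∀ u v → cF G u v ≡ cF G v u
  cF-sym u v = ℕₚ.≤-antisym (le u v) (le v u)
    where
    swap : ∀ {u v} → ((allV ∖ u) ∖ v) ⊆ ((allV ∖ v) ∖ u)
    swap h with ∖⁻ h
    ... | h′ , ≢v = ∖⁺ (∖⁺ ∈allV ≢v) (proj₂ (∖⁻ h′))

    -- Deleting `u` and `v` in either order gives sets that agree only pointwise. Representatives
    -- are least vertices of components, so they agree as well.
    isRep-cong : ∀ {S S′} → S ⊆ S′ → S′ ⊆ S → isRep G S ⊆ isRep G S′
    isRep-cong {S} {S′} s s′ {w} wr with isRep⁻ S wr
    ... | wS , min with rep S′ (s wS)
    ...   | v , vr , p with ℕₚ.<-cmp (toℕ v) (toℕ w)
    ...     | tri< v<w _ _ = contradiction v<w (min (widen s′ p))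
    ...     | tri≈ _ v≡w _ = subst (_∈ isRep G S′) (Finₚ.toℕ-injective v≡w) vr
    ...     | tri> _ _ w<v = contradiction w<v (proj₂ (isRep⁻ S′ vr) (reverse p))

    le : ∀ u v → cF G u v ≤ cF G v u
    le u v rewrite cF≡ u v | cF≡ v u = countV-mono {p = bridge u v} {bridge v u} λ {w} h →
      let r , tu , tv = bridge⁻ h
          _ , p , e   = touches⁻ tu
          _ , p′ , e′ = touches⁻ tv
      in bridge⁺ (isRep-cong swap swap r) (touches⁺ (widen swap p′) e′) (touches⁺ (widen swap p) e)

-- Blocks

module Blocks {n} {G : Adj n} (G-sym : ∀ {x y} → G x y ≡ true → G y x ≡ true)
              (G-conn : ∀ {x y} → Path G allV x y) where

  open Components {G = G} G-sym

  block-graph⁻ : ∀ {S} → IsBlockGraph G S → (∀ {x y} → x ∈ S → y ∈ S → Path G S x y) ×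
                 (∀ {z x y} → x ∈ (S ∖ z) → y ∈ (S ∖ z) → Path G (S ∖ z) x y)
  block-graph⁻ {S} (c , no-cut) = Connected⇒Path S c , del
    where
    del : ∀ {z x y} → x ∈ (S ∖ z) → y ∈ (S ∖ z) → Path G (S ∖ z) x y
    del {z} x∈ y∈ with z ∈? S
    ... | no z∉S = widen (λ {v} v∈S → ∖⁺ v∈S λ { refl → z∉S v∈S }) (Connected⇒Path S c (∖⊆ x∈) (∖⊆ y∈))
    ... | yes (mem zS) = ncomp≤1⇒Path (S ∖ z) (subst (ncomp G (S ∖ z) ≤_) c (ℕₚ.≮⇒≥ λ lt →
            false⇒∉ {S = isCutvertexOn G S} (no-cut z)
              (mem (∧⁺ zS (Equivalence.to Boolₚ.T-≡ (ℕₚ.<⇒<ᵇ lt)))))) x∈ y∈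

  block-graph⁺ : ∀ {S x} → x ∈ S → (∀ {x y} → x ∈ S → y ∈ S → Path G S x y) →
                 (∀ {z x y} → x ∈ (S ∖ z) → y ∈ (S ∖ z) → Path G (S ∖ z) x y) → IsBlockGraph G S
  block-graph⁺ {S} xS path del = c , λ z → Boolₚ.¬-not λ h →
      let lt = ℕₚ.<ᵇ⇒< (ncomp G S) _ (Equivalence.from Boolₚ.T-≡ (proj₂ (∧⁻ {S z} h)))
      in ℕₚ.<⇒≱ (subst (_< ncomp G (S ∖ z)) c lt) (Path⇒ncomp≤1 (S ∖ z) del)
    where
    c : ConnectedOn G S
    c = Path⇒Connected S xS path

  -- The vertices that no single vertex x separates from S ∖ x. For a block graph S with at
  -- least two vertices this is the block containing S.
  InHull : VSet n → Fin n → Set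
  InHull S z = ∀ x → x ≢ z → ∃ λ b → b ∈ (S ∖ x) × Path G (allV ∖ x) z b

  inHull? : ∀ S z → Dec (InHull S z)
  inHull? S z = Finₚ.all? λ x → ¬? (x ≟ z) →-dec
                Finₚ.any? λ b → (b ∈? (S ∖ x)) ×-dec Path? (allV ∖ x) z b

  opaque
    hull : VSet n → VSet n
    hull S z = isYes (inHull? S z)

    hull⁺ : ∀ {S z} → InHull S z → z ∈ hull S
    hull⁺ {S} {z} h = mem (isYes⁺ (inHull? S z) h)

    hull⁻ : ∀ {S z} → z ∈ hull S → InHull S z
    hull⁻ {S} {z} (mem h) = isYes⁻ (inHull? S z) h

  ⊆hull : ∀ {S} → S ⊆ hull S
  ⊆hull z∈S = hull⁺ λ x x≢z → _ , ∖⁺ z∈S (x≢z ∘ sym) , nil (∖⁺ ∈allV (x≢z ∘ sym))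

  -- Once the walk is cut at its last visit to `z`, the next vertex `z′` is in the hull again:
  -- deleting `z` leaves it the rest of the walk to `b`, and deleting any other vertex leaves it the
  -- edge to `z` and the walk that `z` has.
  hull-walk : ∀ {S} m {Q z b} → countV Q ≤ m → z ∈ hull S → b ∈ S → Path G Q z b → Path G (hull S ∩ Q) z b
  hull-walk zero c _ _ p = contradiction (ℕₚ.≤-trans (countV-some (source∈ p)) c) λ ()
  hull-walk {S} (suc m) {Q} {z} {b} c zH bS p with last-visit p
  ... | inj₁ refl          = nil (∩⁺ zH (source∈ p))
  ... | inj₂ (z′ , e , q) = cons (∩⁺ zH (source∈ p)) e
          (widen (λ h → let hH , hQ = ∩⁻ h in ∩⁺ hH (∖⊆ hQ))
            (hull-walk m (s≤s⁻¹ (ℕₚ.≤-trans (countV-∖ (source∈ p)) c)) z′H bS q))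
    where
    z′H : z′ ∈ hull S
    z′H = hull⁺ λ x x≢z′ → case x x≢z′ (x ≟ z)
      where
      case : ∀ x → x ≢ z′ → Dec (x ≡ z) → ∃ λ b → b ∈ (S ∖ x) × Path G (allV ∖ x) z′ b
      case x x≢z′ (yes refl) = b , ∖⁺ bS (proj₂ (∖⁻ (target∈ q))) ,
                               widen (λ h → ∖⁺ ∈allV (proj₂ (∖⁻ h))) q
      case x x≢z′ (no x≢z) with hull⁻ zH x x≢z
      ... | b″ , b″S , p″ = b″ , b″S , cons (∖⁺ ∈allV (x≢z′ ∘ sym)) (G-sym e) p″

  -- After the deletion of `v`, any two vertices of the hull still walk inside it to vertices of `S`
  -- other than `v`, and these are connected because `S` is a block graph.
  hull-block-graph : ∀ {S x} → x ∈ S → IsBlockGraph G S → IsBlockGraph G (hull S)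
  hull-block-graph {S} xS bg = block-graph⁺ (⊆hull xS)
      (λ yH zH → to-x yH ++ reverse (to-x zH))
      (λ {v} yH zH → let b , bS , p = hull⁻ (∖⊆ yH) v (proj₂ (∖⁻ yH) ∘ sym)
                         b′ , b′S , p′ = hull⁻ (∖⊆ zH) v (proj₂ (∖⁻ zH) ∘ sym)
        in (avoid (∖⊆ yH) (∖⊆ bS) p ++
            widen (λ h → ∖⁺ (⊆hull (∖⊆ h)) (proj₂ (∖⁻ h))) (proj₂ (block-graph⁻ bg) bS b′S)) ++
           reverse (avoid (∖⊆ zH) (∖⊆ b′S) p′))
    where
    walk : ∀ {Q z b} → z ∈ hull S → b ∈ S → Path G Q z b → Path G (hull S ∩ Q) z b
    walk = hull-walk n (countV≤n _)

    to-x : ∀ {y} → y ∈ hull S → Path G (hull S) y _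
    to-x yH = widen (proj₁ ∘ ∩⁻) (walk yH xS G-conn)

    avoid : ∀ {v y b} → y ∈ hull S → b ∈ S → Path G (allV ∖ v) y b → Path G (hull S ∖ v) y b
    avoid yH bS p = widen (λ h → let hH , hv = ∩⁻ h in ∖⁺ hH (proj₂ (∖⁻ hv))) (walk yH bS p)

  ⊆-antisym : ∀ {S S′ : VSet n} → S ⊆ S′ → S′ ⊆ S → ∀ x → S x ≡ S′ x
  ⊆-antisym {S} {S′} s s′ x with x ∈? S | x ∈? S′
  ... | yes p | yes q = trans (holds p) (sym (holds q))
  ... | yes p | no ¬q = contradiction (s p) ¬q
  ... | no ¬p | yes q = contradiction (s′ q) ¬p
  ... | no ¬p | no ¬q = trans (∉⇒false ¬p) (sym (∉⇒false ¬q))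

  one-of : ∀ {S : VSet n} {p q} → p ∈ S → q ∈ S → p ≢ q → ∀ x → ∃ (_∈ (S ∖ x))
  one-of {p = p} {q} pS qS p≢q x with p ≟ x
  ... | no p≢x   = p , ∖⁺ pS p≢x
  ... | yes refl = q , ∖⁺ qS (p≢q ∘ sym)

  -- For maximality: a block graph containing `S` stays connected after any deletion, and one of
  -- `p`, `q` survives it, so all its vertices satisfy `InHull`.
  hull-block : ∀ {S p q} → p ∈ S → q ∈ S → p ≢ q → IsBlockGraph G S → IsBlock G (hull S)
  hull-block {S} pS qS p≢q bg = hull-block-graph pS bg , λ S′ H⊆S′ bg′ →
    let s = λ {x} (h : x ∈ hull S) → mem (H⊆S′ x (holds h)) in
    ⊆-antisym (λ {z} zS′ → hull⁺ λ x x≢z →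
      let b , bS = one-of pS qS p≢q x
      in b , bS , widen (λ h → ∖⁺ ∈allV (proj₂ (∖⁻ h)))
           (proj₂ (block-graph⁻ bg′) (∖⁺ zS′ (x≢z ∘ sym)) (∖⁺ (s (⊆hull (∖⊆ bS))) (proj₂ (∖⁻ bS))))) s

  hull⊆ : ∀ {S x} → x ∈ S → IsBlock G S → hull S ⊆ S
  hull⊆ {S} xS (bg , max) {z} (mem zH) =
    mem (trans (sym (max (hull S) (λ _ h → holds (⊆hull (mem h))) (hull-block-graph xS bg) z)) zH)

  edge-block-graph : ∀ {w y} → G w y ≡ true → IsBlockGraph G (⁅ w ⁆ ∪ ⁅ y ⁆)
  edge-block-graph {w} {y} e = block-graph⁺ (∪⁺ˡ ⁅⁆⁺) (path id)
      (λ {z} a b → path {Q = (⁅ w ⁆ ∪ ⁅ y ⁆) ∖ z} ∖⊆ a b)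
    where
    path : ∀ {Q} → Q ⊆ (⁅ w ⁆ ∪ ⁅ y ⁆) → ∀ {a b} → a ∈ Q → b ∈ Q → Path G Q a b
    path s aQ bQ with ∪⁻ (s aQ) | ∪⁻ (s bQ)
    ... | inj₁ a | inj₁ b with refl ← ⁅⁆⁻ a | refl ← ⁅⁆⁻ b = nil aQ
    ... | inj₁ a | inj₂ b with refl ← ⁅⁆⁻ a | refl ← ⁅⁆⁻ b = edge aQ bQ e
    ... | inj₂ a | inj₁ b with refl ← ⁅⁆⁻ a | refl ← ⁅⁆⁻ b = edge aQ bQ (G-sym e)
    ... | inj₂ a | inj₂ b with refl ← ⁅⁆⁻ a | refl ← ⁅⁆⁻ b = nil aQ

  -- No single vertex cuts `y` off from `S`: the walk to `s` survives the deletion of `w`, and the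
  -- edge to `w` survives every other one. So `y` is in the hull, which is the block itself.
  absorb : ∀ {S w s y} → IsBlock G S → w ∈ S → s ∈ (S ∖ w) → G w y ≡ true → Path G (allV ∖ w) y s → y ∈ S
  absorb {S} {w} {s} {y} bl wS sS e p = hull⊆ wS bl (hull⁺ λ x x≢y → case x x≢y (x ≟ w))
    where
    case : ∀ x → x ≢ y → Dec (x ≡ w) → ∃ λ b → b ∈ (S ∖ x) × Path G (allV ∖ x) y b
    case x x≢y (yes refl) = s , sS , p
    case x x≢y (no x≢w) = w , ∖⁺ wS (x≢w ∘ sym) ,
      edge (∖⁺ ∈allV (x≢y ∘ sym)) (∖⁺ ∈allV (x≢w ∘ sym)) (G-sym e)

  two-common⇒⊆ : ∀ {S S′ p q} → IsBlock G S → IsBlock G S′ → p ∈ (S ∩ S′) → q ∈ (S ∩ S′) → p ≢ q → S′ ⊆ S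
  two-common⇒⊆ bl bl′ p∈ q∈ p≢q zS′ = hull⊆ (proj₁ (∩⁻ p∈)) bl (hull⁺ λ x x≢z →
    let b , b∈ = one-of p∈ q∈ p≢q x
        bS , bS′ = ∩⁻ (∖⊆ b∈)
        b≢x = proj₂ (∖⁻ b∈)
    in b , ∖⁺ bS b≢x , widen (λ h → ∖⁺ ∈allV (proj₂ (∖⁻ h)))
         (proj₂ (block-graph⁻ (proj₁ bl′)) (∖⁺ zS′ (x≢z ∘ sym)) (∖⁺ bS′ b≢x)))

  -- The rooted block-cutvertex tree

  module BlockTree {k} (B : Fin (suc k) → VSet n) (B-enum : IsBlockEnumeration G B)
                   (r s : Fin (suc k) → Fin n) (rs-edge : ∀ i → G (r i) (s i) ≡ true)
                   (r≢s : ∀ i → r i ≢ s i)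
                   (rB : ∀ i → r i ∈ B i) (sB : ∀ i → s i ∈ B i)
                   (root : ∀ i → i ≢ zero → IsRootVertex G B i (r i)) where

    private
      r₀ = r zero
      block = proj₁ B-enum

    common⇒≡ : ∀ {i j p q} → p ∈ B i → p ∈ B j → q ∈ B i → q ∈ B j → p ≢ q → i ≡ j
    common⇒≡ {i} {j} pi pj qi qj p≢q = proj₁ (proj₂ B-enum) i j
      (⊆-antisym (two-common⇒⊆ (block j) (block i) (∩⁺ pj pi) (∩⁺ qj qi) p≢q)
                 (two-common⇒⊆ (block i) (block j) (∩⁺ pi pj) (∩⁺ qi qj) p≢q))

    edge-block : ∀ {w y} → w ≢ y → G w y ≡ true → ∃ λ i → w ∈ B i × y ∈ B i
    edge-block {w} {y} w≢y e
      with proj₂ (proj₂ B-enum) _ (hull-block (∪⁺ˡ ⁅⁆⁺) (∪⁺ʳ {S = ⁅ w ⁆} ⁅⁆⁺) w≢y (edge-block-graph e))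
    ... | i , eq = i , in-B (⊆hull (∪⁺ˡ ⁅⁆⁺)) , in-B (⊆hull (∪⁺ʳ {S = ⁅ w ⁆} ⁅⁆⁺))
      where
      in-B : ∀ {x} → x ∈ hull (⁅ w ⁆ ∪ ⁅ y ⁆) → x ∈ B i
      in-B {x} (mem h) = mem (trans (eq x) h)

    neighbour : ∀ {i p} → p ∈ B i → ∃ λ y → G p y ≡ true × y ∈ (B i ∖ p)
    neighbour {i} {p} pB with one-of (rB i) (sB i) (r≢s i) p
    ... | q , q∈ with last-visit (proj₁ (block-graph⁻ (proj₁ (block i))) pB (∖⊆ q∈))
    ...   | inj₁ refl        = contradiction q∈ u∉∖u
    ...   | inj₂ (y , e , p′) = y , e , source∈ p′

    -- If G - p were connected, `B i` would absorb a neighbour of `p` in `B j`, and the two blocks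
    -- would share two vertices.
    shared⇒cutvertex : ∀ {i j p} → i ≢ j → p ∈ B i → p ∈ B j → isCutvertexOn G allV p ≡ true
    shared⇒cutvertex {i} {j} {p} i≢j pi pj =
      Equivalence.to Boolₚ.T-≡ (ℕₚ.<⇒<ᵇ (ℕₚ.≰⇒> λ le → i≢j (same (ℕₚ.≤-trans le
        (Path⇒ncomp≤1 allV λ _ _ → G-conn)))))
      where
      same : ncomp G (allV ∖ p) ≤ 1 → i ≡ j
      same c with neighbour pi | neighbour pj
      ... | y , e , yi | z , e′ , zj =
        common⇒≡ pi pj (absorb (block i) pi yi e′ path) (∖⊆ zj) (proj₂ (∖⁻ zj) ∘ sym)
        where
        path : Path G (allV ∖ p) z y
        path = ncomp≤1⇒Path (allV ∖ p) c (∖⁺ ∈allV (proj₂ (∖⁻ zj))) (∖⁺ ∈allV (proj₂ (∖⁻ yi)))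

    private
      tree = bcTree G B
      bn : Fin (suc k) → Fin (suc k + n)
      bn = blockNode {n} {k}
      vn : Fin n → Fin (suc k + n)
      vn = vertexNode {n} {k}

    tree-edge : ∀ i x → tree (bn i) (vn x) ≡ B i x ∧ isCutvertexOn G allV x ×
                        tree (vn x) (bn i) ≡ B i x ∧ isCutvertexOn G allV x
    tree-edge i x rewrite Finₚ.splitAt-↑ˡ (suc k) i n | Finₚ.splitAt-↑ʳ (suc k) n x = refl , refl

    block-node∈ : ∀ {c} i → bn i ∈ (allV ∖ vn c)
    block-node∈ {c} i = ∖⁺ ∈allV λ eq → case trans (sym (Finₚ.splitAt-↑ˡ (suc k) i n))
      (trans (cong (splitAt (suc k)) eq) (Finₚ.splitAt-↑ʳ (suc k) n c)) of λ ()

    tree-hop : ∀ {c p i j} → p ≢ c → p ∈ B i → p ∈ B j → Path tree (allV ∖ vn c) (bn i) (bn j)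
    tree-hop {c} {p} {i} {j} p≢c pi pj with i ≟ j
    ... | yes refl = nil (block-node∈ i)
    ... | no i≢j = cons (block-node∈ i) (trans (proj₁ (tree-edge i p)) (∧⁺ (holds pi) cut))
                     (edge (∖⁺ ∈allV (p≢c ∘ Finₚ.↑ʳ-injective (suc k) p c)) (block-node∈ j)
                       (trans (proj₂ (tree-edge j p)) (∧⁺ (holds pj) cut)))
      where
      cut = shared⇒cutvertex i≢j pi pj

    -- Every edge of the walk lies in a block, and successive blocks coincide or share a cutvertex
    -- other than `c`. This carries separation in the block-cutvertex tree over to G.
    tree-path : ∀ {c p q i j} → Path G (allV ∖ c) p q → p ∈ B i → q ∈ B j →
                Path tree (allV ∖ vn c) (bn i) (bn j)
    tree-path (nil p∈) pi pj = tree-hop (proj₂ (∖⁻ p∈)) pi pj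
    tree-path {p = p} (cons {y = p′} p∈ e path) pi qj with p ≟ p′
    ... | yes refl = tree-path path pi qj
    ... | no p≢p′ with edge-block p≢p′ e
    ...   | l , pl , p′l = tree-hop (proj₂ (∖⁻ p∈)) pi pl ++ tree-path path p′l qj

    root-separates : ∀ {i p} → i ≢ zero → p ∈ B i → ¬ Path G (allV ∖ r i) p r₀
    root-separates {i} i≢0 pi path =
      false⇒∉ {S = conn tree (allV ∖ vn (r i)) (bn i)} (proj₂ (root i i≢0)) (conn⁺ (tree-path path pi (rB zero)))

    s∈behind : ∀ i → s i ∈ behind r₀ (r i)
    s∈behind i = behind⁺ (r≢s i ∘ sym) λ p → case i ≟ zero of λ
      { (yes refl) → u∉∖u (source∈ p)
      ; (no i≢0)   → root-separates i≢0 (sB i) (reverse p) }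

    -- The last departure from `w` towards `x` uses an edge of some block `B i`, and `B i` without
    -- `w` is connected, so all of it is behind `w`. Suppose `r i` were not `w`. If `i` is zero, r₀
    -- would be behind `w`. Otherwise a walk from `w` to r₀ that does not return to `w` cannot meet
    -- `r i`, which is behind `w`; this contradicts `root-separates`.
    behind-block : ∀ {w x} → x ∈ behind r₀ w → ∃ λ i → r i ≡ w × Path G (allV ∖ w) x (s i)
    behind-block {w} {x} x∈ with last-visit {S = allV} (G-conn {w} {x})
    ... | inj₁ refl = contradiction refl (proj₁ (behind⁻ x∈))
    ... | inj₂ (y , e , y→x) with edge-block (λ { refl → u∉∖u (source∈ y→x) }) e
    ...   | i , wi , yi = i , r≡w , reverse y→x ++ in-block yi y≢w (sB i) (λ eq → r≢s i (trans r≡w (sym eq)))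
      where
      y≢w = proj₂ (∖⁻ (source∈ y→x))

      in-block : ∀ {a b} → a ∈ B i → a ≢ w → b ∈ B i → b ≢ w → Path G (allV ∖ w) a b
      in-block ai a≢w bi b≢w = widen (λ h → ∖⁺ ∈allV (proj₂ (∖⁻ h)))
        (proj₂ (block-graph⁻ (proj₁ (block i))) (∖⁺ ai a≢w) (∖⁺ bi b≢w))

      r₀≢→ : ∀ {a} → a ∈ B i → a ≢ w → ¬ Path G (allV ∖ w) r₀ a
      r₀≢→ ai a≢w p = proj₂ (behind⁻ x∈) (p ++ (in-block ai a≢w yi y≢w ++ y→x))

      r≡w : r i ≡ w
      r≡w with r i ≟ w
      ... | yes eq = eq
      ... | no r≢w with i ≟ zero
      ...   | yes refl = contradiction (nil (∖⁺ ∈allV r≢w)) (r₀≢→ (rB zero) r≢w)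
      ...   | no i≢0 with last-visit {S = allV} (G-conn {w} {r₀})
      ...     | inj₁ refl = contradiction (nil (∖⁺ ∈allV (r≢w ∘ sym))) (root-separates i≢0 wi)
      ...     | inj₂ (z , e′ , p) = contradiction
                  (cons (∖⁺ ∈allV (r≢w ∘ sym)) e′
                    (restrict (λ q → ∖⁺ ∈allV λ { refl → r₀≢→ (rB i) r≢w (reverse q) }) p))
                  (root-separates i≢0 wi)

    -- `B j` absorbs `s i`, so the two blocks share the root vertex and `s i` and are equal.
    s-unique : ∀ {i j} → r i ≡ r j → Path G (allV ∖ r i) (s i) (s j) → s i ≡ s j
    s-unique {i} {j} eq p = cong s (common⇒≡ (rB i) (subst (_∈ B j) (sym eq) (rB j))
      (sB i) (absorb (block j) (rB j) (∖⁺ (sB j) (r≢s j ∘ sym)) (subst (λ w → G w (s i) ≡ true) eq (rs-edge i))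
        (subst (λ w → Path G (allV ∖ w) (s i) (s j)) eq p)) (r≢s i))

-- K₄-minor-freeness yields separating vertices

module Separator {n} {G : Adj n} (G-sym : ∀ {x y} → G x y ≡ true → G y x ≡ true)
                 (X : VSet n) (u v : Fin n) (u∉X : u ∉ X) (v∉X : v ∉ X) (u≢v : u ≢ v)
                 (X-conn : ∀ {x y} → x ∈ X → y ∈ X → Path G X x y)
                 (outside : Path G (∁ X) u v) where

  open Components {G = G} G-sym

  Separates : Fin n → Set
  Separates a = a ∈ X × (∀ {x y} → G u x ≡ true → Path G (X ∖ a) x y → ¬ G y v ≡ true)

  Linked : VSet n → Fin n → Set
  Linked C c = ∃ λ x → Path G C c x × G x u ≡ true

  -- The second alternative counts `u` as a vertex of every fan, which lets both fans start empty.
  Meets : VSet n → Fin n → Set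
  Meets C e = (∃ λ c → c ∈ C × G c e ≡ true) ⊎ (e ∈ X × G e u ≡ true)

  AdjTo : VSet n → VSet n → Set
  AdjTo C F = ∃ λ e → e ∈ F × Meets C e

  adjTo? : ∀ C F → Dec (AdjTo C F)
  adjTo? C F = Finₚ.any? λ e → (e ∈? F) ×-dec
    ((Finₚ.any? λ c → (c ∈? C) ×-dec (G c e Boolₚ.≟ true)) ⊎-dec ((e ∈? X) ×-dec (G e u Boolₚ.≟ true)))

  -- Two disjoint fans C, D growing out of u towards the connected set E around v. Moving
  -- vertices from E to C or D ends with both fans adjacent to v, or finds a separating vertex.
  record Fans (C D E : VSet n) : Set where
    field
      C⊆X   : C ⊆ X
      D⊆X   : D ⊆ X
      cover  : ∀ {x} → x ∈ X → x ∈ C ⊎ x ∈ D ⊎ x ∈ E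
      E⊆    : ∀ {x} → x ∈ E → x ∈ X ⊎ x ≡ v
      C∩D   : Disjoint C D
      C∩E   : Disjoint C E
      D∩E   : Disjoint D E
      v∈E   : v ∈ E
      E-conn : ∀ {e} → e ∈ E → Path G E e v
      C-link : ∀ {c} → c ∈ C → Linked C c
      D-link : ∀ {c} → c ∈ D → Linked D c
      C-adj  : AdjTo C E
      D-adj  : AdjTo D E

  open Fans

  swap-fans : ∀ {C D E} → Fans C D E → Fans D C E
  swap-fans S = record
    { C⊆X = D⊆X S ; D⊆X = C⊆X S
    ; cover = λ x → [ inj₂ ∘ inj₁ , [ inj₁ , inj₂ ∘ inj₂ ]′ ]′ (cover S x)
    ; E⊆ = E⊆ S ; C∩D = λ p q → C∩D S q p ; C∩E = D∩E S ; D∩E = C∩E S ; v∈E = v∈E S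
    ; E-conn = E-conn S ; C-link = D-link S ; D-link = C-link S ; C-adj = D-adj S ; D-adj = C-adj S }

  grow : ∀ {C D E F} → Fans C D E → F ⊆ E → v ∈ F → (∀ {e} → e ∈ F → Path G F e v) →
         (∀ {e} → e ∈ (E ∩ ∁ F) → Linked (C ∪ (E ∩ ∁ F)) e) →
         AdjTo (C ∪ (E ∩ ∁ F)) F → AdjTo D F → Fans (C ∪ (E ∩ ∁ F)) D F
  grow {C} {D} {E} {F} S F⊆E v∈F F-conn link C-adj′ D-adj′ = record
    { C⊆X = λ x∈ → [ C⊆X S , (λ x∈′ → let xE , x∉F = ∩⁻ x∈′ in
        [ id , (λ { refl → contradiction v∈F (∁⁻ x∉F) }) ]′ (E⊆ S xE)) ]′ (∪⁻ x∈)
    ; D⊆X = D⊆X S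
    ; cover = λ {x} xX → [ inj₁ ∘ ∪⁺ˡ , [ inj₂ ∘ inj₁ , (λ xE → case x ∈? F of λ
        { (yes xF) → inj₂ (inj₂ xF) ; (no x∉F) → inj₁ (∪⁺ʳ (∩⁺ xE (∁⁺ x∉F))) }) ]′ ]′ (cover S xX)
    ; E⊆ = E⊆ S ∘ F⊆E
    ; C∩D = λ xC xD → [ (λ xC → C∩D S xC xD) , (λ h → D∩E S xD (proj₁ (∩⁻ h))) ]′ (∪⁻ xC)
    ; C∩E = λ xC xF → [ (λ xC → C∩E S xC (F⊆E xF)) , (λ h → ∁⁻ (proj₂ (∩⁻ h)) xF) ]′ (∪⁻ xC)
    ; D∩E = λ xD xF → D∩E S xD (F⊆E xF)
    ; v∈E = v∈F
    ; E-conn = F-conn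
    ; C-link = λ c∈ → [ (λ cC → let x , p , e = C-link S cC in x , widen ∪⁺ˡ p , e) , link ]′ (∪⁻ c∈)
    ; D-link = D-link S
    ; C-adj = C-adj′
    ; D-adj = D-adj′ }

  -- `F` is what remains around `v` when `z` is removed from `E`, and the rest `R` hangs together
  -- through `z`. One fan may take `R` as long as the other still meets `F`. If neither fan meets
  -- `F`, then `z` separates.
  step : ∀ {C D E z} → Fans C D E → z ∈ E → z ≢ v → Meets C z →
         Separates z ⊎ ∃ λ C′ → ∃ λ D′ → ∃ λ E′ → Fans C′ D′ E′ × countV E′ < countV E
  step {C} {D} {E} {z} S zE z≢v mz = go (adjTo? D F) (adjTo? C F)
    where
    F R : VSet n
    F = conn G (E ∖ z) v
    R = E ∩ ∁ F

    v∈F : v ∈ F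
    v∈F = conn⁺ (nil (∖⁺ (v∈E S) (z≢v ∘ sym)))

    F⊆E : F ⊆ E
    F⊆E h = ∖⊆ (target∈ (conn⁻ h))

    z∉F : z ∉ F
    z∉F h = u∉∖u (target∈ (conn⁻ h))

    F-conn : ∀ {e} → e ∈ F → Path G F e v
    F-conn eF = component-connected (E ∖ z) eF v∈F

    F-closed : ∀ {p q} → p ∈ F → q ∈ E → q ≢ z → G p q ≡ true → q ∈ F
    F-closed pF qE q≢z e = let p = conn⁻ pF in conn⁺ (p ++ edge (target∈ p) (∖⁺ qE q≢z) e)

    enter : ∀ {e} → e ∈ R → Path G R e z × ∃ λ f → f ∈ F × G z f ≡ true
    enter eR with exit (∁ F) (E-conn S (proj₁ (∩⁻ eR))) (proj₂ (∩⁻ eR)) (λ h → ∁⁻ h v∈F)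
    ... | p , q , path , e , qE , q∉ with q ∈? F
    ...   | no q∉F = contradiction (∁⁺ q∉F) q∉
    ...   | yes qF with p ≟ z
    ...     | yes refl = path , q , qF , e
    ...     | no p≢z = contradiction
                (F-closed qF (proj₁ (∩⁻ (target∈ path))) p≢z (G-sym e)) (∁⁻ (proj₂ (∩⁻ (target∈ path))))

    zR : z ∈ R
    zR = ∩⁺ zE (∁⁺ z∉F)

    linked-at : ∀ {C} → C ⊆ X → (∀ {c} → c ∈ C → Linked C c) → ∀ {e₀} → e₀ ∈ R → Meets C e₀ →
                ∀ {e} → e ∈ R → Linked (C ∪ R) e
    linked-at C⊆X link e₀R m eR with widen {S′ = _ ∪ R} ∪⁺ʳ
                (proj₁ (enter eR) ++ reverse (proj₁ (enter e₀R))) | m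
    ... | p | inj₂ (_ , e) = _ , p , e
    ... | p | inj₁ (c , cC , e) with link cC
    ...   | x , q , e′ = x , p ++ cons (target∈ p) (G-sym e) (widen ∪⁺ˡ q) , e′

    z-meets : ∀ C → AdjTo (C ∪ R) F
    z-meets C = let f , fF , e = proj₂ (enter zR) in f , fF , inj₁ (z , ∪⁺ʳ zR , e)

    smaller : countV F < countV E
    smaller = countV-mono-< F⊆E z∉F zE

    go : Dec (AdjTo D F) → Dec (AdjTo C F) →
         Separates z ⊎ ∃ λ C′ → ∃ λ D′ → ∃ λ E′ → Fans C′ D′ E′ × countV E′ < countV E
    go (yes d) _ = inj₂ (_ , _ , F ,
      grow S F⊆E v∈F F-conn (linked-at (C⊆X S) (C-link S) zR mz) (z-meets C) d , smaller)
    -- `D` meets `E` but not `F`, so it meets `R`, and the fans change roles.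
    go (no ¬d) (yes c) with D-adj S
    ... | e , eE , m = inj₂ (_ , _ , F ,
      grow (swap-fans S) F⊆E v∈F F-conn
        (linked-at (D⊆X S) (D-link S) (∩⁺ eE (∁⁺ λ eF → ¬d (e , eF , m))) m) (z-meets D) c , smaller)
    go (no ¬d) (no ¬c) = inj₁ ([ id , (λ z≡v → contradiction z≡v z≢v) ]′ (E⊆ S zE) ,
      λ u→x path y→v → ¬c (_ , into-F path (G-sym y→v) , inj₂ (∖⊆ (source∈ path) , G-sym u→x)))
      where
      next : ∀ {p q} → p ∈ F → q ∈ (X ∖ z) → G p q ≡ true → q ∈ F
      next pF q∈ e with cover S (∖⊆ q∈)
      ... | inj₁ qC        = contradiction (_ , pF , inj₁ (_ , qC , G-sym e)) ¬c
      ... | inj₂ (inj₁ qD) = contradiction (_ , pF , inj₁ (_ , qD , G-sym e)) ¬d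
      ... | inj₂ (inj₂ qE) = F-closed pF qE (proj₂ (∖⁻ q∈)) e

      -- Followed back from a neighbour of `v`, a walk avoiding `z` never leaves `F`, since no fan
      -- is adjacent to `F`. Were its start a neighbour of `u`, that start would itself be a place
      -- where `C` meets `F`.
      into-F : ∀ {x y} → Path G (X ∖ z) x y → G v y ≡ true → x ∈ F
      into-F (nil x∈) e = next v∈F x∈ e
      into-F (cons x∈ e′ p) e = next (into-F p e) x∈ (G-sym e′)

  TwoFans : Set
  TwoFans = ∃ λ C → ∃ λ D → ∃ λ E → Fans C D E × (∃ λ b → b ∈ C × G b v ≡ true) × (∃ λ b → b ∈ D × G b v ≡ true)

  find-fans : ∀ m {C D E} → countV E ≤ m → Fans C D E → ∃ Separates ⊎ TwoFans
  find-fans zero c S = contradiction (ℕₚ.≤-trans (countV-some (v∈E S)) c) λ ()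
  find-fans (suc m) {C} {D} {E} c S = go (C-adj S) (D-adj S)
    where
    continue : ∀ {C D z} → Fans C D E → z ∈ E → z ≢ v → Meets C z → ∃ Separates ⊎ TwoFans
    continue S zE z≢v mz with step S zE z≢v mz
    ... | inj₁ sep = inj₁ (_ , sep)
    ... | inj₂ (_ , _ , _ , S′ , lt) = find-fans m (s≤s⁻¹ (ℕₚ.≤-trans lt c)) S′

    at-v : ∀ {C z} → z ≡ v → Meets C z → ∃ λ b → b ∈ C × G b v ≡ true
    at-v refl (inj₁ m)        = m
    at-v refl (inj₂ (vX , _)) = contradiction vX v∉X

    go : AdjTo C E → AdjTo D E → ∃ Separates ⊎ TwoFans
    go (z , zE , mz) (z′ , zE′ , mz′) with z ≟ v | z′ ≟ v
    ... | no z≢v | _       = continue S zE z≢v mz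
    ... | yes _  | no z≢v  = continue (swap-fans S) zE′ z≢v mz′
    ... | yes eq | yes eq′ = inj₂ (C , D , E , S , at-v eq mz , at-v eq′ mz′)

  start : ∀ {x y} → x ∈ X → G x u ≡ true → y ∈ X → G y v ≡ true → Fans ∅ ∅ (X ∪ ⁅ v ⁆)
  start {x} {y} xX xu yX yv = record
    { C⊆X = λ h → contradiction h (false⇒∉ refl) ; D⊆X = λ h → contradiction h (false⇒∉ refl)
    ; cover = inj₂ ∘ inj₂ ∘ ∪⁺ˡ
    ; E⊆ = Sum.map id ⁅⁆⁻ ∘ ∪⁻
    ; C∩D = λ h _ → false⇒∉ refl h ; C∩E = λ h _ → false⇒∉ refl h ; D∩E = λ h _ → false⇒∉ refl h
    ; v∈E = ∪⁺ʳ ⁅⁆⁺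
    ; E-conn = λ e∈ → [ to-v , (λ h → subst (λ e → Path G _ e v) (sym (⁅⁆⁻ h)) (nil (∪⁺ʳ ⁅⁆⁺))) ]′ (∪⁻ e∈)
    ; C-link = λ h → contradiction h (false⇒∉ refl) ; D-link = λ h → contradiction h (false⇒∉ refl)
    ; C-adj = x , ∪⁺ˡ xX , inj₂ (xX , xu) ; D-adj = x , ∪⁺ˡ xX , inj₂ (xX , xu) }
    where
    to-v : ∀ {e} → e ∈ X → Path G (X ∪ ⁅ v ⁆) e v
    to-v eX = widen ∪⁺ˡ (X-conn eX yX) ++ edge (∪⁺ˡ yX) (∪⁺ʳ ⁅⁆⁺) yv

  module Minor {C D E} (S : Fans C D E) {b d} (b∈ : b ∈ C) (bv : G b v ≡ true) (d∈ : d ∈ D) (dv : G d v ≡ true) where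

    private
      -- Together with `v` alone, the branch sets of a K₄. `X₂` is taken in all of `X` outside `X₁`,
      -- not just in `D`, so that the connectedness of `X` forces an edge between `X₁` and `X₂`.
      X₁ X₂ U : VSet n
      X₁ = conn G C b
      X₂ = conn G (X ∩ ∁ X₁) d
      U  = conn G (∁ X ∖ v) u

    X₁⊆X : X₁ ⊆ X
    X₁⊆X h = C⊆X S (target∈ (conn⁻ h))

    d∈X∖X₁ : d ∈ X ∩ ∁ X₁
    d∈X∖X₁ = ∩⁺ (D⊆X S d∈) (∁⁺ λ h → C∩D S (target∈ (conn⁻ h)) d∈)

    X₂⊆X : X₂ ⊆ X
    X₂⊆X h = proj₁ (∩⁻ (target∈ (conn⁻ h)))

    X₁∩X₂ : Disjoint X₁ X₂
    X₁∩X₂ h₁ h₂ = ∁⁻ (proj₂ (∩⁻ (target∈ (conn⁻ h₂)))) h₁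

    u∈U : u ∈ U
    u∈U = conn⁺ (nil (∖⁺ (∁⁺ u∉X) u≢v))

    U∩X : Disjoint U X
    U∩X h = ∁⁻ (∖⊆ (target∈ (conn⁻ h)))

    X₁u : ∃ λ x → x ∈ X₁ × G x u ≡ true
    X₁u = let x , p , e = C-link S b∈ in x , conn⁺ p , e

    X₂u : ∃ λ x → x ∈ X₂ × G x u ≡ true
    X₂u = let x , p , e = D-link S d∈ in x , conn⁺ (widen (λ h → ∩⁺ (D⊆X S h)
            (∁⁺ λ h′ → C∩D S (target∈ (conn⁻ h′)) h)) p) , e

    U-v : ∃ λ x → x ∈ U × G x v ≡ true
    U-v with last-visit (reverse outside)
    ... | inj₁ v≡u         = contradiction (sym v≡u) u≢v
    ... | inj₂ (z , e , p) = z , conn⁺ (reverse p) , G-sym e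

    X₁-X₂ : ∃ λ x → ∃ λ y → x ∈ X₁ × y ∈ X₂ × G x y ≡ true
    X₁-X₂ with exit X₂ (X-conn (D⊆X S d∈) (C⊆X S b∈)) (conn⁺ (nil d∈X∖X₁)) (X₁∩X₂ (conn⁺ (nil b∈)))
    ... | p , q , path , e , qX , q∉X₂ with q ∈? X₁
    ...   | yes q∈X₁ = q , p , q∈X₁ , proj₂ (∩⁻ (target∈ path)) , G-sym e
    ...   | no q∉X₁ = let r = conn⁻ (proj₂ (∩⁻ (target∈ path))) in
              contradiction (conn⁺ (r ++ edge (target∈ r) (∩⁺ qX (∁⁺ q∉X₁)) e)) q∉X₂

    β : Fin n → Maybe (Fin 4)
    β x with x ∈? X₁ | x ∈? X₂ | x ∈? U | x ≟ v
    ... | yes _ | _     | _     | _     = just zero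
    ... | no _  | yes _ | _     | _     = just (Fin.suc zero)
    ... | no _  | no _  | yes _ | _     = just (Fin.suc (Fin.suc zero))
    ... | no _  | no _  | no _  | yes _ = just (Fin.suc (Fin.suc (Fin.suc zero)))
    ... | no _  | no _  | no _  | no _  = nothing

    branch : Fin 4 → VSet n
    branch zero                                  = X₁
    branch (Fin.suc zero)                     = X₂
    branch (Fin.suc (Fin.suc zero))           = U
    branch (Fin.suc (Fin.suc (Fin.suc zero))) = ⁅ v ⁆

    β⁺ : ∀ i {x} → x ∈ branch i → β x ≡ just i
    β⁺ i {x} x∈ with x ∈? X₁ | x ∈? X₂ | x ∈? U | x ≟ v
    β⁺ zero x∈ | yes _ | _ | _ | _ = refl
    β⁺ zero x∈ | no x∉ | _ | _ | _ = contradiction x∈ x∉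
    β⁺ (Fin.suc zero) x∈ | yes p | _ | _ | _ = contradiction x∈ (X₁∩X₂ p)
    β⁺ (Fin.suc zero) x∈ | no _ | yes _ | _ | _ = refl
    β⁺ (Fin.suc zero) x∈ | no _ | no x∉ | _ | _ = contradiction x∈ x∉
    β⁺ (Fin.suc (Fin.suc zero)) x∈ | yes p | _ | _ | _ = contradiction (X₁⊆X p) (U∩X x∈)
    β⁺ (Fin.suc (Fin.suc zero)) x∈ | no _ | yes p | _ | _ = contradiction (X₂⊆X p) (U∩X x∈)
    β⁺ (Fin.suc (Fin.suc zero)) x∈ | no _ | no _ | yes _ | _ = refl
    β⁺ (Fin.suc (Fin.suc zero)) x∈ | no _ | no _ | no x∉ | _ = contradiction x∈ x∉
    β⁺ (Fin.suc (Fin.suc (Fin.suc zero))) x∈ | p? | q? | r? | s? with ⁅⁆⁻ x∈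
    β⁺ (Fin.suc (Fin.suc (Fin.suc zero))) x∈ | yes p | _ | _ | _ | refl = contradiction (X₁⊆X p) v∉X
    β⁺ (Fin.suc (Fin.suc (Fin.suc zero))) x∈ | no _ | yes p | _ | _ | refl = contradiction (X₂⊆X p) v∉X
    β⁺ (Fin.suc (Fin.suc (Fin.suc zero))) x∈ | no _ | no _ | yes p | _ | refl = contradiction (target∈ (conn⁻ p)) u∉∖u
    β⁺ (Fin.suc (Fin.suc (Fin.suc zero))) x∈ | no _ | no _ | no _ | yes _ | refl = refl
    β⁺ (Fin.suc (Fin.suc (Fin.suc zero))) x∈ | no _ | no _ | no _ | no ≢ | refl = contradiction refl ≢

    β⁻ : ∀ i {x} → β x ≡ just i → x ∈ branch i
    β⁻ i {x} eq with x ∈? X₁ | x ∈? X₂ | x ∈? U | x ≟ v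
    β⁻ _ refl | yes p | _ | _ | _ = p
    β⁻ _ refl | no _ | yes p | _ | _ = p
    β⁻ _ refl | no _ | no _ | yes p | _ = p
    β⁻ _ refl | no _ | no _ | no _ | yes refl = ⁅⁆⁺
    β⁻ _ () | no _ | no _ | no _ | no _

    inBranch⁺ : ∀ i → branch i ⊆ inBranch β i
    inBranch⁺ i {x} x∈ = mem (lemma (β⁺ i x∈))
      where
      lemma : β x ≡ just i → inBranch β i x ≡ true
      lemma eq with β x
      lemma refl | just j = ==-refl j

    inBranch⁻ : ∀ i → inBranch β i ⊆ branch i
    inBranch⁻ i {x} (mem h) = β⁻ i lemma
      where
      lemma : β x ≡ just i
      lemma with β x
      ... | just j = cong just (sym (isYes⁻ (i ≟ j) h))

    branch-conn : ∀ i {x y} → x ∈ branch i → y ∈ branch i → Path G (branch i) x y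
    branch-conn zero                                 = component-connected C
    branch-conn (Fin.suc zero)                     = component-connected (X ∩ ∁ X₁)
    branch-conn (Fin.suc (Fin.suc zero))           = component-connected (∁ X ∖ v)
    branch-conn (Fin.suc (Fin.suc (Fin.suc zero))) x∈ y∈
      with refl ← ⁅⁆⁻ x∈ | refl ← ⁅⁆⁻ y∈ = nil x∈

    branch-some : ∀ i → ∃ (_∈ branch i)
    branch-some zero                                 = b , conn⁺ (nil b∈)
    branch-some (Fin.suc zero)                     = d , conn⁺ (nil d∈X∖X₁)
    branch-some (Fin.suc (Fin.suc zero))           = u , u∈U
    branch-some (Fin.suc (Fin.suc (Fin.suc zero))) = v , ⁅⁆⁺

    branch-adj : ∀ i j → toℕ i < toℕ j → ∃ λ x → ∃ λ y → x ∈ branch i × y ∈ branch j × G x y ≡ true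
    branch-adj zero (Fin.suc zero) _ = X₁-X₂
    branch-adj zero (Fin.suc (Fin.suc zero)) _ = let x , x∈ , e = X₁u in x , u , x∈ , u∈U , e
    branch-adj zero (Fin.suc (Fin.suc (Fin.suc zero))) _ = b , v , conn⁺ (nil b∈) , ⁅⁆⁺ , bv
    branch-adj (Fin.suc zero) (Fin.suc (Fin.suc zero)) _ = let x , x∈ , e = X₂u in x , u , x∈ , u∈U , e
    branch-adj (Fin.suc zero) (Fin.suc (Fin.suc (Fin.suc zero))) _ = d , v , conn⁺ (nil d∈X∖X₁) , ⁅⁆⁺ , dv
    branch-adj (Fin.suc (Fin.suc zero)) (Fin.suc (Fin.suc (Fin.suc zero))) _ = let x , x∈ , e = U-v in x , v , x∈ , ⁅⁆⁺ , e
    branch-adj (Fin.suc zero) (Fin.suc zero) (s≤s ())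
    branch-adj (Fin.suc (Fin.suc zero)) (Fin.suc zero) (s≤s ())
    branch-adj (Fin.suc (Fin.suc zero)) (Fin.suc (Fin.suc zero)) (s≤s (s≤s ()))
    branch-adj (Fin.suc (Fin.suc (Fin.suc zero))) (Fin.suc zero) (s≤s ())
    branch-adj (Fin.suc (Fin.suc (Fin.suc zero))) (Fin.suc (Fin.suc zero)) (s≤s (s≤s ()))
    branch-adj (Fin.suc (Fin.suc (Fin.suc zero))) (Fin.suc (Fin.suc (Fin.suc zero))) (s≤s (s≤s (s≤s ())))

    K₄-minor : HasK4Minor G
    K₄-minor = β , connected , adjacent
      where
      connected : ∀ i → ConnectedOn G (inBranch β i)
      connected i = Path⇒Connected (inBranch β i) (inBranch⁺ i (proj₂ (branch-some i)))
        λ x∈ y∈ → widen (inBranch⁺ i) (branch-conn i (inBranch⁻ i x∈) (inBranch⁻ i y∈))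

      adjacent : ∀ i j → i ≢ j → Σ (Fin n) λ x → Σ (Fin n) λ y → β x ≡ just i × β y ≡ just j × G x y ≡ true
      adjacent i j i≢j with ℕₚ.<-cmp (toℕ i) (toℕ j)
      ... | tri< lt _ _ = let x , y , x∈ , y∈ , e = branch-adj i j lt in x , y , β⁺ i x∈ , β⁺ j y∈ , e
      ... | tri≈ _ eq _ = contradiction (Finₚ.toℕ-injective eq) i≢j
      ... | tri> _ _ gt = let x , y , x∈ , y∈ , e = branch-adj j i gt in y , x , β⁺ i y∈ , β⁺ j x∈ , G-sym e

  separator : K4MinorFree G → ∀ {x y} → x ∈ X → G x u ≡ true → y ∈ X → G y v ≡ true → ∃ Separates
  separator free xX xu yX yv with find-fans n (countV≤n _) (start xX xu yX yv)
  ... | inj₁ sep = sep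
  ... | inj₂ (_ , _ , _ , S , (_ , b∈ , bv) , (_ , d∈ , dv)) = contradiction (Minor.K₄-minor S b∈ bv d∈ dv) free

-- Partial solutions: connected pieces of a spanning subgraph with bounded degrees

module _ {n : ℕ} where

  opaque

    infixr 6 _⊔_

    _⊔_ : Adj n → Adj n → Adj n
    (H ⊔ K) x y = H x y ∨ K x y

    ⊔⁻ : ∀ {H K : Adj n} {x y} → (H ⊔ K) x y ≡ true → H x y ≡ true ⊎ K x y ≡ true
    ⊔⁻ = ∨⁻

    ⊔⁺ˡ : ∀ {H K : Adj n} {x y} → H x y ≡ true → (H ⊔ K) x y ≡ true
    ⊔⁺ˡ = ∨⁺ˡ

    ⊔⁺ʳ : ∀ {H K : Adj n} {x y} → K x y ≡ true → (H ⊔ K) x y ≡ true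
    ⊔⁺ʳ {H} {x = x} {y} = ∨⁺ʳ {H x y}

    ⊔-false : ∀ {H K : Adj n} {x y} → H x y ≡ false → K x y ≡ false → (H ⊔ K) x y ≡ false
    ⊔-false p q rewrite p | q = refl

    none : Adj n
    none _ _ = false

    none⁻ : ∀ {x y} → none x y ≢ true
    none⁻ ()

    single : Fin n → Fin n → Adj n
    single a b x y = (x == a ∧ y == b) ∨ (x == b ∧ y == a)

    single⁺ : ∀ a b → single a b a b ≡ true
    single⁺ a b = ∨⁺ˡ (∧⁺ (==-refl a) (==-refl b))

    single⁻ : ∀ {a b x y} → single a b x y ≡ true → (x ≡ a × y ≡ b) ⊎ (x ≡ b × y ≡ a)
    single⁻ {a} {b} {x} {y} h = Sum.map
      (λ h → let p , q = ∧⁻ h in isYes⁻ (x ≟ a) p , isYes⁻ (y ≟ b) q)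
      (λ h → let p , q = ∧⁻ h in isYes⁻ (x ≟ b) p , isYes⁻ (y ≟ a) q) (∨⁻ h)

    single-sym : ∀ {a b x y} → single a b x y ≡ true → single a b y x ≡ true
    single-sym {a} {b} {x} {y} h with single⁻ {a} {b} {x} {y} h
    ... | inj₁ (refl , refl) = ∨⁺ʳ {y == x ∧ x == y} (∧⁺ (==-refl y) (==-refl x))
    ... | inj₂ (refl , refl) = single⁺ a b

  deg-≤ : ∀ (H : Adj n) {Y} v → (∀ {y} → H v y ≡ true → y ∈ Y) → deg H v ≤ countV Y
  deg-≤ H v h = countV-mono {p = H v} λ (mem e) → h e

  deg-mono : ∀ (H K : Adj n) → (∀ {x y} → H x y ≡ true → K x y ≡ true) → ∀ v → deg H v ≤ deg K v
  deg-mono H K H⊆K v = deg-≤ H {K v} v λ e → mem (H⊆K e)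

  deg-⊔ : ∀ (H K : Adj n) v → deg (H ⊔ K) v ≤ deg H v + deg K v
  deg-⊔ H K v = ℕₚ.≤-trans
    (deg-≤ (H ⊔ K) {H v ∪ K v} v λ {y} e → [ (λ e → ∪⁺ˡ (mem e)) , (λ e → ∪⁺ʳ {S = H v} (mem e)) ]′ (⊔⁻ {H} {K} {v} {y} e))
    (countV-∪ (H v) (K v))

  deg-⊔ˡ : ∀ (H K : Adj n) v → (∀ {y} → K v y ≢ true) → deg (H ⊔ K) v ≤ deg H v
  deg-⊔ˡ H K v ¬K = deg-≤ (H ⊔ K) {H v} v λ {y} e → mem ([ id , (λ e → contradiction e ¬K) ]′ (⊔⁻ {H} {K} {v} {y} e))

  deg-⊔ʳ : ∀ (H K : Adj n) v → (∀ {y} → H v y ≢ true) → deg (H ⊔ K) v ≤ deg K v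
  deg-⊔ʳ H K v ¬H = deg-≤ (H ⊔ K) {K v} v λ {y} e → mem ([ (λ e → contradiction e ¬H) , id ]′ (⊔⁻ {H} {K} {v} {y} e))

  deg-zero : ∀ (H : Adj n) v → (∀ {y} → H v y ≢ true) → deg H v ≡ 0
  deg-zero H v h = countV-none {p = H v} λ _ (mem e) → h e

  deg-single : ∀ {a b} → a ≢ b → deg (single a b) a ≤ 1
  deg-single {a} {b} a≢b = ℕₚ.≤-trans (deg-≤ (single a b) {⁅ b ⁆} a λ {y} e → case single⁻ {a} {b} {a} {y} e of λ
    { (inj₁ (_ , refl)) → ⁅⁆⁺ ; (inj₂ (a≡b , _)) → contradiction a≡b a≢b }) (countV-⁅⁆ b)

  deg-singleʳ : ∀ {a b} → a ≢ b → deg (single a b) b ≤ 1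
  deg-singleʳ {a} {b} a≢b = ℕₚ.≤-trans (deg-≤ (single a b) {⁅ a ⁆} b λ {y} e → case single⁻ {a} {b} {b} {y} e of λ
    { (inj₁ (b≡a , _)) → contradiction (sym b≡a) a≢b ; (inj₂ (_ , refl)) → ⁅⁆⁺ }) (countV-⁅⁆ a)

module Solutions {n k : ℕ} (G : Adj n) (f : Fin n → ℕ) (ω : Fin n → Fin n → ℕ)
                 (r s : Fin (suc k) → Fin n) where

  -- Zero off the nontrivial 2-cuts, where the values of `ω` are arbitrary.
  ω̂ : Fin n → Fin n → ℕ
  ω̂ t x = if isNontrivialTwoCut G t x then ω t x else 0

  opaque

    -- The part of the sum over 𝓕(t) contributed by the 2-cuts {t,x} with x ∈ X.
    Ω : VSet n → Fin n → ℕ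
    Ω X t = sumL (λ x → if X x then ω̂ t x else 0) (allFin n)

    Ω-all : ∀ t → Ω allV t ≡ sumω G ω t
    Ω-all t = refl

    Ω-mono : ∀ {X Y} → X ⊆ Y → ∀ t → Ω X t ≤ Ω Y t
    Ω-mono {X} {Y} X⊆Y t = sumL-mono le (allFin n)
      where
      le : ∀ x → (if X x then ω̂ t x else 0) ≤ (if Y x then ω̂ t x else 0)
      le x with X x in eq
      ... | false = z≤n
      ... | true rewrite holds (X⊆Y (mem {x = x} eq)) = ℕₚ.≤-refl

    Ω-∪ : ∀ {X Y} → Disjoint X Y → ∀ t → Ω X t + Ω Y t ≤ Ω (X ∪ Y) t
    Ω-∪ {X} {Y} X∩Y t = sumL-+ le (allFin n)
      where
      le : ∀ x → (if X x then ω̂ t x else 0) + (if Y x then ω̂ t x else 0) ≤ (if (X ∪ Y) x then ω̂ t x else 0)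
      le x with X x in xX | Y x in xY
      ... | true  | true  = contradiction (mem xY) (X∩Y (mem {x = x} xX))
      ... | true  | false rewrite holds (∪⁺ˡ {S′ = Y} (mem {x = x} {S = X} xX)) = ℕₚ.≤-reflexive (ℕₚ.+-identityʳ _)
      ... | false | true  rewrite holds (∪⁺ʳ {S = X} (mem {x = x} {S = Y} xY)) = ℕₚ.≤-refl
      ... | false | false = z≤n

    Ω-⁅⁆ : ∀ t a → ω̂ t a ≤ Ω ⁅ a ⁆ t
    Ω-⁅⁆ t a = subst (_≤ Ω ⁅ a ⁆ t) (cong (λ b → if b then ω̂ t a else 0) (holds (⁅⁆⁺ {x = a})))
                 (∈⇒≤sumL (λ x → if ⁅ a ⁆ x then ω̂ t x else 0) (∈-allFin a))

  -- R selects the indices i for which H must meet the requirements on s i and the edge r i s i.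
  record Local (P : Fin n → Set) (X : VSet n) (R : Fin (suc k) → Set) (H : Adj n) : Set where
    field
      sub    : ∀ {x y} → H x y ≡ true → G x y ≡ true
      symm   : ∀ {x y} → H x y ≡ true → H y x ≡ true
      supp   : ∀ {x y} → H x y ≡ true → P x
      degree : ∀ {x} → x ∈ X → deg H x ≤ f x
      inside : ∀ {i} → R i → s i ∈ X
      tight  : ∀ {i} → R i → suc (deg H (s i)) ≤ f (s i)
      absent : ∀ {i} → R i → cF G (r i) (s i) ≡ 1 → H (r i) (s i) ≡ false

  open Local public

  weaken : ∀ {P P′ X X′ R R′ H} → Local P X R H → (∀ {x} → P x → P′ x) → X′ ⊆ X →
           (∀ {i} → R′ i → R i) → (∀ {i} → R′ i → s i ∈ X′) → Local P′ X′ R′ H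
  weaken L P⊆ X⊇ R⊇ in′ = record
    { sub = sub L ; symm = symm L ; supp = P⊆ ∘ supp L ; degree = degree L ∘ X⊇
    ; inside = in′ ; tight = tight L ∘ R⊇ ; absent = absent L ∘ R⊇ }

  module _ {P P′ X X′ R R′ H K} (L : Local P X R H) (L′ : Local P′ X′ R′ K)
           (X∌P′ : ∀ {x} → x ∈ X → ¬ P′ x) (X′∌P : ∀ {x} → x ∈ X′ → ¬ P x) where

    private
      deg-X : ∀ {x} → x ∈ X → deg (H ⊔ K) x ≤ deg H x
      deg-X {x} xX = deg-⊔ˡ H K x (X∌P′ xX ∘ supp L′)

      deg-X′ : ∀ {x} → x ∈ X′ → deg (H ⊔ K) x ≤ deg K x
      deg-X′ {x} xX = deg-⊔ʳ H K x (X′∌P xX ∘ supp L)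

    -- Each support avoids the vertices controlled by the other summand, so degrees and edges at a
    -- controlled vertex come from one summand only.
    join : Local (λ x → P x ⊎ P′ x) (X ∪ X′) (λ i → R i ⊎ R′ i) (H ⊔ K)
    join = record
      { sub = [ sub L , sub L′ ]′ ∘ ⊔⁻
      ; symm = [ ⊔⁺ˡ ∘ symm L , ⊔⁺ʳ ∘ symm L′ ]′ ∘ ⊔⁻
      ; supp = Sum.map (supp L) (supp L′) ∘ ⊔⁻
      ; degree = λ x∈ → [ (λ xX → ℕₚ.≤-trans (deg-X xX) (degree L xX))
                         , (λ xX → ℕₚ.≤-trans (deg-X′ xX) (degree L′ xX)) ]′ (∪⁻ x∈)
      ; inside = [ ∪⁺ˡ ∘ inside L , ∪⁺ʳ ∘ inside L′ ]′
      ; tight = [ (λ Ri → ℕₚ.≤-trans (s≤s (deg-X (inside L Ri))) (tight L Ri))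
                , (λ Ri → ℕₚ.≤-trans (s≤s (deg-X′ (inside L′ Ri))) (tight L′ Ri)) ]′
      ; absent = [ (λ Ri c → ⊔-false (absent L Ri c) (Boolₚ.¬-not λ e → X∌P′ (inside L Ri) (supp L′ (symm L′ e))))
                 , (λ Ri c → ⊔-false (Boolₚ.¬-not λ e → X′∌P (inside L′ Ri) (supp L (symm L e))) (absent L′ Ri c)) ]′ }

  -- e and e′ are the degrees allowed at u and v beyond Ω; L and N switch the last two conditions on.
  record Sol (X : VSet n) (u v : Fin n) (e e′ : ℕ) (L N : Set) : Set where
    field
      graph   : Adj n
      local   : Local (λ x → x ∈ X ⊎ x ≡ u ⊎ x ≡ v) X (λ i → r i ∈ X × s i ∈ X) graph
      deg-u   : deg graph u ≤ e + Ω X u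
      deg-v   : deg graph v ≤ e′ + Ω X v
      joined  : ∀ {x} → x ∈ X → Path graph allV x u ⊎ Path graph allV x v
      linked  : L → Path graph allV u v
      no-edge : N → graph u v ≡ false

  -- `p` is meant to count the components of `X`, at one unit of degree each. Here `s i ∈ X` alone
  -- selects an index, as `r i` may be the terminal `a`.
  record Pendant (X : VSet n) (a : Fin n) (p : ℕ) : Set where
    field
      graph  : Adj n
      local  : Local (λ x → x ∈ X ⊎ x ≡ a) X (λ i → s i ∈ X) graph
      deg-a  : deg graph a ≤ p + Ω X a
      joined : ∀ {x} → x ∈ X → Path graph allV x a

  swap-sol : ∀ {X u v e e′ L N} → Sol X u v e e′ L N → Sol X v u e′ e L N
  swap-sol {X} {u} {v} {L = L} {N} S = record
    { graph = H ; local = weaken (local S) (Sum.map id Sum.swap) id id proj₂ ; deg-u = deg-v S ; deg-v = deg-u S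
    ; joined = Sum.swap ∘ joined S
    ; linked = λ l → Components.reverse {G = H} (symm (local S)) (linked S l)
    ; no-edge = λ N → Boolₚ.¬-not λ e → false⇒∉ {S = H u} (no-edge S N) (mem (symm (local S) e)) }
    where
    open Sol
    H = graph S

  weaken-sol : ∀ {X u v e₁ e₂ e₁′ e₂′ L L′ N N′} → e₁ ≤ e₁′ → e₂ ≤ e₂′ → (L′ → L) → (N′ → N) →
               Sol X u v e₁ e₂ L N → Sol X u v e₁′ e₂′ L′ N′
  weaken-sol le le′ l l′ S = record
    { graph = graph ; local = local ; joined = joined
    ; deg-u = ℕₚ.≤-trans deg-u (ℕₚ.+-monoˡ-≤ _ le) ; deg-v = ℕₚ.≤-trans deg-v (ℕₚ.+-monoˡ-≤ _ le′)
    ; linked = linked ∘ l ; no-edge = no-edge ∘ l′ }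
    where open Sol S

  deg-join : ∀ {H K : Adj n} {X Y t d e} → Disjoint X Y → deg H t ≤ d + Ω X t → deg K t ≤ e + Ω Y t →
             deg (H ⊔ K) t ≤ (d + e) + Ω (X ∪ Y) t
  deg-join {H} {K} {X} {Y} {t} {d} {e} X∩Y h k = begin
    deg (H ⊔ K) t                ≤⟨ deg-⊔ H K t ⟩
    deg H t + deg K t            ≤⟨ ℕₚ.+-mono-≤ h k ⟩
    (d + Ω X t) + (e + Ω Y t)    ≡⟨ interchange d (Ω X t) e (Ω Y t) ⟩
    (d + e) + (Ω X t + Ω Y t)    ≤⟨ ℕₚ.+-monoʳ-≤ (d + e) (Ω-∪ X∩Y t) ⟩
    (d + e) + Ω (X ∪ Y) t        ∎
    where
    open ℕₚ.≤-Reasoning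

  join-sol : ∀ {U C u v e₁ e₂ e₁′ e₂′ L L′} →
    u ∉ U → v ∉ U → u ∉ C → v ∉ C → Disjoint U C →
    (∀ {i} → r i ∈ U ∪ C → s i ∈ U ∪ C → (r i ∈ U × s i ∈ U) ⊎ (r i ∈ C × s i ∈ C)) →
    Sol U u v e₁ e₂ L ⊤ → Sol C u v e₁′ e₂′ L′ ⊤ → Sol (U ∪ C) u v (e₁ + e₁′) (e₂ + e₂′) (L ⊎ L′) ⊤
  join-sol {U} {C} {u} {v} u∉U v∉U u∉C v∉C U∩C split S S′ = record
    { graph = graph S ⊔ graph S′
    ; local = weaken (join (local S) (local S′)
        (λ { xU (inj₁ xC) → U∩C xU xC ; xU (inj₂ (inj₁ refl)) → u∉U xU ; xU (inj₂ (inj₂ refl)) → v∉U xU })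
        (λ { xC (inj₁ xU) → U∩C xU xC ; xC (inj₂ (inj₁ refl)) → u∉C xC ; xC (inj₂ (inj₂ refl)) → v∉C xC }))
        [ Sum.map ∪⁺ˡ id , Sum.map ∪⁺ʳ id ]′ id (λ (ri , si) → split ri si) proj₂
    ; deg-u = deg-join U∩C (deg-u S) (deg-u S′)
    ; deg-v = deg-join U∩C (deg-v S) (deg-v S′)
    ; joined = λ x∈ → [ Sum.map (gmap ⊔⁺ˡ id) (gmap ⊔⁺ˡ id) ∘ joined S
                      , Sum.map (gmap ⊔⁺ʳ id) (gmap ⊔⁺ʳ id) ∘ joined S′ ]′ (∪⁻ x∈)
    ; linked = [ gmap ⊔⁺ˡ id ∘ linked S , gmap ⊔⁺ʳ id ∘ linked S′ ]′
    ; no-edge = λ _ → ⊔-false (no-edge S tt) (no-edge S′ tt) }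
    where open Sol

  join-pendant : ∀ {U C a p q} → a ∉ U → a ∉ C → Disjoint U C →
    Pendant U a p → Pendant C a q → Pendant (U ∪ C) a (p + q)
  join-pendant a∉U a∉C U∩C S S′ = record
    { graph = graph S ⊔ graph S′
    ; local = weaken (join (local S) (local S′)
        (λ { xU (inj₁ xC) → U∩C xU xC ; xU (inj₂ refl) → a∉U xU })
        (λ { xC (inj₁ xU) → U∩C xU xC ; xC (inj₂ refl) → a∉C xC }))
        [ Sum.map ∪⁺ˡ id , Sum.map ∪⁺ʳ id ]′ id ∪⁻ id
    ; deg-a = deg-join U∩C (deg-a S) (deg-a S′)
    ; joined = λ x∈ → [ gmap ⊔⁺ˡ id ∘ joined S , gmap ⊔⁺ʳ id ∘ joined S′ ]′ (∪⁻ x∈) }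
    where open Pendant

  weaken-pendant : ∀ {X Y a p} → X ⊆ Y → Y ⊆ X → Pendant X a p → Pendant Y a p
  weaken-pendant X⊆Y Y⊆X S = record
    { graph = graph ; local = weaken local (Sum.map X⊆Y id) Y⊆X Y⊆X id
    ; deg-a = ℕₚ.≤-trans deg-a (ℕₚ.+-monoʳ-≤ _ (Ω-mono X⊆Y _)) ; joined = joined ∘ Y⊆X }
    where open Pendant S

  no-graph : ∀ {P R} → (∀ {i} → ¬ R i) → Local P ∅ R none
  no-graph ¬R = record
    { sub = λ e → contradiction e none⁻ ; symm = λ e → contradiction e none⁻ ; supp = λ e → contradiction e none⁻
    ; degree = λ h → contradiction h (false⇒∉ refl) ; inside = λ Ri → contradiction Ri ¬R
    ; tight = λ Ri → contradiction Ri ¬R ; absent = λ Ri → contradiction Ri ¬R }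

  deg-none : ∀ t {d} → deg (none {n}) t ≤ d
  deg-none t = ℕₚ.≤-trans (ℕₚ.≤-reflexive (deg-zero (none {n}) t none⁻)) z≤n

  no-sol : ∀ {u v e e′} → Sol ∅ u v e e′ ⊥ ⊤
  no-sol {u} {v} = record
    { graph = none ; local = no-graph λ (h , _) → false⇒∉ refl h
    ; deg-u = deg-none u ; deg-v = deg-none v
    ; joined = λ h → contradiction h (false⇒∉ refl) ; linked = λ () ; no-edge = λ _ → Boolₚ.¬-not none⁻ }

  no-pendant : ∀ {a} → Pendant ∅ a 0
  no-pendant {a} = record
    { graph = none ; local = no-graph (false⇒∉ refl)
    ; deg-a = deg-none a
    ; joined = λ h → contradiction h (false⇒∉ refl) }

  edge-sol : ∀ {U u v e e′ N} → u ≢ v → G u v ≡ true → G v u ≡ true → (∀ x → x ∉ U) → ¬ N → Sol U u v (suc e) (suc e′) ⊤ N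
  edge-sol {U} {u} {v} u≢v uv vu empty ¬N = record
    { graph = single u v
    ; local = record
      { sub = λ h → case single⁻ h of λ { (inj₁ (refl , refl)) → uv ; (inj₂ (refl , refl)) → vu }
      ; symm = single-sym
      ; supp = λ h → inj₂ (Sum.map proj₁ proj₁ (single⁻ h))
      ; degree = λ h → contradiction h (empty _) ; inside = proj₂
      ; tight = λ (h , _) → contradiction h (empty _) ; absent = λ (h , _) → contradiction h (empty _) }
    ; deg-u = ℕₚ.≤-trans (deg-single u≢v) (s≤s z≤n)
    ; deg-v = ℕₚ.≤-trans (deg-singleʳ u≢v) (s≤s z≤n)
    ; joined = λ h → contradiction h (empty _)
    ; linked = λ _ → edge ∈allV ∈allV (single⁺ u v)
    ; no-edge = λ N → contradiction N ¬N }

-- Spanning trees of connected graphs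

module _ {n : ℕ} where

  opaque
    del : Fin n → Fin n → Adj n → Adj n
    del x y H p q = H p q ∧ not (single x y p q)

    del⁺ : ∀ {x y H p q} → H p q ≡ true → single x y p q ≢ true → del x y H p q ≡ true
    del⁺ e ne = ∧⁺ e (not⁺ ne)

    del⁻ : ∀ {x y H p q} → del x y H p q ≡ true → H p q ≡ true × single x y p q ≢ true
    del⁻ {H = H} {p} {q} h = let e , ne = ∧⁻ {H p q} h in e , not⁻ ne

  record SpanningTreeOf (H T : Adj n) (l : List (Fin n × Fin n)) : Set where
    field
      sub       : ∀ {x y} → T x y ≡ true → H x y ≡ true
      symm      : ∀ {x y} → T x y ≡ true → T y x ≡ true
      connected : ∀ {x y} → Path T allV x y
      bridges   : ∀ {x y} → (x , y) List.∈ l → T x y ≡ true → ¬ Path (del x y T) allV x y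

  -- An edge is kept only if its deletion would separate its ends. Later deletions shrink the graph
  -- further, so that verdict persists.
  prune : ∀ l {H : Adj n} → (∀ {x y} → H x y ≡ true → H y x ≡ true) → (∀ {x y} → Path H allV x y) →
          ∃ λ T → SpanningTreeOf H T l
  prune [] {H} H-sym H-conn = H , record { sub = id ; symm = H-sym ; connected = H-conn ; bridges = λ () }
  prune ((x , y) ∷ l) {H} H-sym H-conn with Path? {G = del x y H} allV x y
  ... | no ¬p with prune l H-sym H-conn
  ...   | T , S = T , record
          { sub = sub ; symm = symm ; connected = connected
          ; bridges = λ { (here refl) _ p → ¬p (gmap (λ e → let e′ , ne = del⁻ e in del⁺ (sub e′) ne) id p)
                        ; (there ∈l) → bridges ∈l } }
    where open SpanningTreeOf S
  prune ((x , y) ∷ l) {H} H-sym H-conn | yes p = T , record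
      { sub = λ e → proj₁ (del⁻ (sub e)) ; symm = symm ; connected = connected
      ; bridges = λ { (here refl) e _ → proj₂ (del⁻ (sub e)) (single⁺ x y) ; (there ∈l) → bridges ∈l } }
    where
    H′-sym : ∀ {a b} → del x y H a b ≡ true → del x y H b a ≡ true
    H′-sym e = let e′ , ne = del⁻ e in del⁺ (H-sym e′) (ne ∘ single-sym)

    reroute : ∀ {a b} → Path H allV a b → Path (del x y H) allV a b
    reroute (nil aV) = nil aV
    reroute (cons {a} {b} aV e q) with single x y a b Boolₚ.≟ true
    ... | no ne = cons aV (del⁺ e ne) (reroute q)
    ... | yes h with single⁻ h
    ...   | inj₁ (refl , refl) = p ++ reroute q
    ...   | inj₂ (refl , refl) = Components.reverse {G = del x y H} H′-sym p ++ reroute q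

    rec : ∃ λ T → SpanningTreeOf (del x y H) T l
    rec = prune l H′-sym (reroute H-conn)

    T = proj₁ rec
    open SpanningTreeOf (proj₂ rec)

  all-pairs : List (Fin n × Fin n)
  all-pairs = cartesianProduct (allFin n) (allFin n)

  along : ∀ {D : Adj n} m (c : Fin (suc m) → Fin n) → (∀ (i : Fin m) → D (c (inject₁ i)) (c (Fin.suc i)) ≡ true) →
          Path D allV (c zero) (c (fromℕ m))
  along zero    c e = nil ∈allV
  along (suc m) c e = cons ∈allV (e zero) (along m (c ∘ Fin.suc) (e ∘ Fin.suc))

  acyclic : ∀ {H T} → SpanningTreeOf H T all-pairs → ¬ HasCycle T
  acyclic {H} {T} S (suc zero , s≤s () , _)
  acyclic {H} {T} S (suc (suc m) , _ , c , inj , e , close) =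
    bridges (∈-cartesianProduct⁺ (∈-allFin _) (∈-allFin _)) close
      (Components.reverse {G = D} D-sym (along {D} (suc (suc m)) c λ i → del⁺ (e i) (other i)))
    where
    open SpanningTreeOf S
    D : Adj n
    D = del (c (fromℕ (suc (suc m)))) (c zero) T

    D-sym : ∀ {a b} → D a b ≡ true → D b a ≡ true
    D-sym h = let h′ , ne = del⁻ h in del⁺ (symm h′) (ne ∘ single-sym)

    other : ∀ i → single (c (fromℕ (suc (suc m)))) (c zero) (c (inject₁ i)) (c (Fin.suc i)) ≢ true
    other i h with single⁻ h
    ... | inj₁ (eq , _) = Finₚ.fromℕ≢inject₁ (sym (inj eq))
    -- Here the cycle must have at least three vertices: its second vertex is not its last.
    other zero h | inj₂ (_ , eq) with () ← inj eq
    other (Fin.suc i) h | inj₂ (eq , _) with () ← inj eq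

-- The recursive construction

module Construction {n k : ℕ} {G : Adj n} (G-sym : ∀ {x y} → G x y ≡ true → G y x ≡ true)
  (G-irrefl : ∀ {x} → G x x ≢ true) (G-conn : ∀ {x y} → Path G allV x y) (free : K4MinorFree G)
  (f : Fin n → ℕ) (ω : Fin n → Fin n → ℕ)
  (ω-split : ∀ u v → NontrivialTwoCut G u v → ω u v + ω v u + 2 ≡ cF G u v)
  (ω-sum : ∀ u → sumω G ω u + ncomp G (allV ∖ u) + 1 ≤ f u)
  (r s : Fin (suc k) → Fin n) (r₀ : Fin n)
  (rs-edge : ∀ i → G (r i) (s i) ≡ true) (cF≤1 : ∀ i → cF G (r i) (s i) ≤ 1)
  (s∈behind : ∀ i → s i ∈ Components.behind {G = G} G-sym r₀ (r i))
  (behind-block : ∀ {w x} → x ∈ Components.behind {G = G} G-sym r₀ w →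
                  ∃ λ i → r i ≡ w × Path G (allV ∖ w) x (s i))
  (s-unique : ∀ {i j} → r i ≡ r j → Path G (allV ∖ r i) (s i) (s j) → s i ≡ s j) where

  open Components {G = G} G-sym
  open Solutions G f ω r s

  private
    pend : Fin n → VSet n
    pend = behind r₀

  -- The walks to r₀ outside `X` fix which side of a vertex of `X` counts as behind it. Put together
  -- they join `u` and `v` outside `X`, as `Separator` requires.
  record Piece (X : VSet n) (u v : Fin n) : Set where
    field
      u∉X       : u ∉ X
      v∉X       : v ∉ X
      u≢v       : u ≢ v
      connected : ∀ {x y} → x ∈ X → y ∈ X → Path G X x y
      closed    : ∀ {x y} → x ∈ X → G x y ≡ true → y ∈ X ⊎ y ≡ u ⊎ y ≡ v
      meets-u   : ∃ λ x → x ∈ X × G x u ≡ true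
      meets-v   : ∃ λ x → x ∈ X × G x v ≡ true
      out-u     : Path G (∁ X) u r₀
      out-v     : Path G (∁ X) v r₀

  swap-piece : ∀ {X u v} → Piece X u v → Piece X v u
  swap-piece P = record
    { u∉X = v∉X ; v∉X = u∉X ; u≢v = u≢v ∘ sym ; connected = connected
    ; closed = λ xX e → Sum.map id Sum.swap (closed xX e)
    ; meets-u = meets-v ; meets-v = meets-u ; out-u = out-v ; out-v = out-u }
    where open Piece P

  -- The second solution spares the terminal `u`; `swap-piece` yields the one that spares `v`.
  Solved : ℕ → Set
  Solved m = ∀ {X u v} → countV X ≤ m → Piece X u v → Sol X u v 1 1 ⊤ ⊤ × Sol X u v 0 1 ⊥ ⊤

  pendants : Fin n → ℕ
  pendants a = countV (isRep G (allV ∖ a) ∩ pend a)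

  Solvedᵖ : ℕ → Set
  Solvedᵖ m = ∀ a → countV (pend a) ≤ m → Pendant (pend a) a (pendants a)

  pendants≤ : ∀ a → pendants a ≤ ncomp G (allV ∖ a)
  pendants≤ a = countV-mono {p = isRep G (allV ∖ a) ∩ pend a} {isRep G (allV ∖ a)} (proj₁ ∘ ∩⁻)

  -- The component of r₀ in G - a is counted on the right only.
  pendants< : ∀ {a} → a ≢ r₀ → pendants a < ncomp G (allV ∖ a)
  pendants< {a} a≢r₀ with rep (allV ∖ a) (∖⁺ ∈allV (a≢r₀ ∘ sym))
  ... | w , wr , p = countV-mono-< (proj₁ ∘ ∩⁻) (λ h → proj₂ (behind⁻ (proj₂ (∩⁻ h))) (reverse p)) wr

  a∉pend : ∀ {a} → a ∉ pend a
  a∉pend h = proj₁ (behind⁻ h) refl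

  to-a : ∀ {X a x} → (∀ {x y} → x ∈ X → y ∈ X → Path G X x y) → a ∈ X → x ∈ X → x ≢ a →
         ∃ λ z → Path G (X ∖ a) x z × G z a ≡ true
  to-a conn aX xX x≢a with last-visit (conn aX xX)
  ... | inj₁ a≡x         = contradiction (sym a≡x) x≢a
  ... | inj₂ (z , e , p) = z , reverse p , G-sym e

  -- A vertex outside `X` that walks towards `a` arrives at a neighbour `p` of `X` before entering
  -- it, and from `p` it reaches r₀ without meeting `a`.
  behind⊆ : ∀ {X a} → a ∈ X → (∀ {p q} → q ∈ X → p ∉ X → G q p ≡ true → Path G (∁ X) p r₀) → pend a ⊆ X
  behind⊆ {X} {a} aX out {x} x∈ with x ∈? X
  ... | yes xX = xX
  ... | no x∉X with exit (∁ X) (G-conn {x} {a}) (∁⁺ x∉X) (λ h → ∁⁻ h aX)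
  ...   | p , q , path , e , _ , q∉ = contradiction
            (widen (λ h → ∖⁺ ∈allV λ { refl → ∁⁻ h aX })
              (reverse (widen (proj₂ ∘ ∩⁻) path ++
                out (decidable-stable (q ∈? X) (q∉ ∘ ∁⁺)) (∁⁻ (proj₂ (∩⁻ (target∈ path)))) (G-sym e))))
            (proj₂ (behind⁻ x∈))

  pend⊆piece : ∀ {X u v a} → Piece X u v → a ∈ X → pend a ⊆ X
  pend⊆piece P a∈X = behind⊆ a∈X λ qX p∉X e → case closed qX e of λ
    { (inj₁ pX) → contradiction pX p∉X ; (inj₂ (inj₁ refl)) → out-u ; (inj₂ (inj₂ refl)) → out-v }
    where open Piece P

  -- Solutions for all components of G - {t,a} in sel combine to one for their union.
  module Bundle {m} (solved : Solved m) {X t a} (t∉X : t ∉ X) (a∈X : a ∈ X) (X≤ : countV X ≤ suc m)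
    (sel : VSet n) (sel⊆ : sel ⊆ bridge t a)
    (sel⊆X : ∀ {w x} → w ∈ sel → Path G ((allV ∖ t) ∖ a) w x → x ∈ X)
    (out-t : Path G (∁ X) t r₀)
    (out-a : ∀ {w} → w ∈ sel → Path G (∁ (conn G ((allV ∖ t) ∖ a) w)) a r₀) where

    S : VSet n
    S = (allV ∖ t) ∖ a

    t≢a : t ≢ a
    t≢a refl = t∉X a∈X

    t∉S : t ∉ S
    t∉S h = proj₂ (∖⁻ {S = allV} (∖⊆ h)) refl

    a∉S : a ∉ S
    a∉S = u∉∖u

    S⁺ : ∀ {x} → x ≢ t → x ≢ a → x ∈ S
    S⁺ x≢t x≢a = ∖⁺ (∖⁺ ∈allV x≢t) x≢a

    component-closed : ∀ {w x y} → x ∈ conn G S w → G x y ≡ true → y ∈ S → y ∈ conn G S w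
    component-closed x∈ e yS = let p = conn⁻ x∈ in conn⁺ (p ++ edge (target∈ p) yS e)

    component-piece : ∀ {w} → w ∈ sel → Piece (conn G S w) t a
    component-piece {w} w∈ with bridge⁻ (sel⊆ w∈)
    ... | wr , mt , ma = record
      { u∉X = t∉S ∘ target∈ ∘ conn⁻ ; v∉X = a∉S ∘ target∈ ∘ conn⁻ ; u≢v = t≢a
      ; connected = component-connected S
      ; closed = closed
      ; meets-u = let x , p , e = touches⁻ mt in x , conn⁺ p , e
      ; meets-v = let x , p , e = touches⁻ ma in x , conn⁺ p , e
      ; out-u = widen (λ h → ∁⁺ λ h′ → ∁⁻ h (sel⊆X w∈ (conn⁻ h′))) out-t
      ; out-v = out-a w∈ }
      where
      closed : ∀ {x y} → x ∈ conn G S w → G x y ≡ true → y ∈ conn G S w ⊎ y ≡ t ⊎ y ≡ a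
      closed {y = y} x∈ e with y ≟ t | y ≟ a
      ... | yes y≡t | _       = inj₂ (inj₁ y≡t)
      ... | no _    | yes y≡a = inj₂ (inj₂ y≡a)
      ... | no y≢t  | no y≢a  = inj₁ (component-closed x∈ e (S⁺ y≢t y≢a))

    component≤ : ∀ {w} → w ∈ sel → countV (conn G S w) ≤ m
    component≤ w∈ = countV-⊂ (sel⊆X w∈ ∘ conn⁻) (a∉S ∘ target∈ ∘ conn⁻) a∈X X≤

    -- All splits of the budget are kept available, so the next component can be charged to
    -- whichever terminal has a unit left. In the second clause one component links `t` with `a`, at
    -- one unit for each, and the other p - 1 share α + β; nothing can link when p is 0.
    Q : ℕ → VSet n → Set
    Q p U = (∀ {α β} → p ≤ α + β → Sol U t a α β ⊥ ⊤) ×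
            (1 ≤ p → ∀ {α β} → p ≤ suc (α + β) → Sol U t a (suc α) (suc β) ⊤ ⊤)

    Q-step : ∀ {p U w} → w ∈ sel → U ⊆ S → Disjoint U (conn G S w) → Q p U → Q (suc p) (U ∪ conn G S w)
    Q-step {p} {U} {w} w∈ U⊆S U∩C (split , _) = (λ {α} {β} → split′ α β) , λ _ {α} {β} le →
        weaken-sol (ℕₚ.≤-reflexive (ℕₚ.+-comm α 1)) (ℕₚ.≤-reflexive (ℕₚ.+-comm β 1)) inj₂ id
          (combine (split (s≤s⁻¹ le)) (proj₁ sols))
      where
      C = conn G S w
      sols = solved (component≤ w∈) (component-piece w∈)
      sols′ = solved (component≤ w∈) (swap-piece (component-piece w∈))

      C⊆S : C ⊆ S
      C⊆S = target∈ ∘ conn⁻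

      same-part : ∀ {i} → r i ∈ U ∪ C → s i ∈ U ∪ C → (r i ∈ U × s i ∈ U) ⊎ (r i ∈ C × s i ∈ C)
      same-part {i} ri si with ∪⁻ ri | ∪⁻ si
      ... | inj₁ rU | inj₁ sU = inj₁ (rU , sU)
      ... | inj₂ rC | inj₂ sC = inj₂ (rC , sC)
      ... | inj₁ rU | inj₂ sC = contradiction (component-closed sC (G-sym (rs-edge i)) (U⊆S rU)) (U∩C rU)
      ... | inj₂ rC | inj₁ sU = contradiction (component-closed rC (rs-edge i) (U⊆S sU)) (U∩C sU)

      combine : ∀ {e₁ e₂ e₁′ e₂′ L L′} → Sol U t a e₁ e₂ L ⊤ → Sol C t a e₁′ e₂′ L′ ⊤ →
                Sol (U ∪ C) t a (e₁ + e₁′) (e₂ + e₂′) (L ⊎ L′) ⊤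
      combine = join-sol (t∉S ∘ U⊆S) (a∉S ∘ U⊆S) (t∉S ∘ C⊆S) (a∉S ∘ C⊆S) U∩C same-part

      split′ : ∀ α β → suc p ≤ α + β → Sol (U ∪ C) t a α β ⊥ ⊤
      split′ (suc α) β le = weaken-sol (ℕₚ.≤-reflexive (ℕₚ.+-comm α 1)) (ℕₚ.≤-reflexive (ℕₚ.+-identityʳ β)) (λ ()) id
        (combine (split (s≤s⁻¹ le)) (swap-sol (proj₂ sols′)))
      split′ zero (suc β) le = weaken-sol z≤n (ℕₚ.≤-reflexive (ℕₚ.+-comm β 1)) (λ ()) id
        (combine (split {0} (s≤s⁻¹ le)) (proj₂ sols))

    opaque
      all : ∃ λ U → Q (countV sel) U × (∀ {x} → x ∈ U → ∃ λ w → w ∈ sel × Path G S w x) ×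
                    (∀ {w x} → w ∈ sel → Path G S w x → x ∈ U)
      all = fold-components S Q sel (λ h → proj₁ (bridge⁻ (sel⊆ h))) ((λ _ → no-sol) , λ ()) Q-step

    U : VSet n
    U = proj₁ all

    U⁻ : ∀ {x} → x ∈ U → ∃ λ w → w ∈ sel × Path G S w x
    U⁻ = proj₁ (proj₂ (proj₂ all))

    U⁺ : ∀ {w x} → w ∈ sel → Path G S w x → x ∈ U
    U⁺ = proj₂ (proj₂ (proj₂ all))

    U⊆S : U ⊆ S
    U⊆S = target∈ ∘ proj₂ ∘ proj₂ ∘ U⁻

    U⊆X : U ⊆ X
    U⊆X h = let _ , w∈ , p = U⁻ h in sel⊆X w∈ p

    a∉U : a ∉ U
    a∉U = a∉S ∘ U⊆S

    U-closed : ∀ {x y} → x ∈ U → G x y ≡ true → y ∈ S → y ∈ U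
    U-closed h e yS = let _ , w∈ , p = U⁻ h in U⁺ w∈ (p ++ edge (target∈ p) yS e)

    -- Vertices of U reach r₀ through t.
    U∩pend : Disjoint U (pend a)
    U∩pend h h′ with U⁻ h
    ... | w , w∈ , p with touches⁻ (proj₁ (proj₂ (bridge⁻ (sel⊆ w∈))))
    ...   | y , q , e = proj₂ (behind⁻ h′) (reverse
              (widen (λ h → ∖⁺ ∈allV (proj₂ (∖⁻ h))) (reverse p ++ q) ++
               cons (∖⁺ ∈allV (proj₂ (∖⁻ (target∈ q)))) e
                 (widen (λ h → ∖⁺ ∈allV λ { refl → ∁⁻ h a∈X }) out-t)))

    split-sol : ∀ {α β} → countV sel ≤ α + β → Sol U t a α β ⊥ (1 ≤ countV sel)
    split-sol le = weaken-sol ℕₚ.≤-refl ℕₚ.≤-refl id (λ _ → tt) (proj₁ (proj₁ (proj₂ all)) le)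

    -- With no component to make the link, the edge from `t` to `a` makes it. Hence that edge is
    -- promised to be absent only if some component is selected.
    linked-sol : ∀ {α β} → countV sel ≤ suc (α + β) → (countV sel ≡ 0 → G t a ≡ true) →
                 Sol U t a (suc α) (suc β) ⊤ (1 ≤ countV sel)
    linked-sol le ta with countV sel ℕₚ.≟ 0
    ... | no pos = weaken-sol ℕₚ.≤-refl ℕₚ.≤-refl id (λ _ → tt) (proj₂ (proj₁ (proj₂ all)) (ℕₚ.n≢0⇒n>0 pos) le)
    ... | yes eq = edge-sol t≢a (ta eq) (G-sym (ta eq))
            (λ x h → ℕₚ.<⇒≢ (countV-some (proj₁ (proj₂ (U⁻ h)))) (sym eq))
            (λ pos → ℕₚ.<⇒≢ pos (sym eq))

  ω̂≡ : ∀ {u v} → u ≢ v → 3 ≤ cF G u v → ω̂ u v ≡ ω u v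
  ω̂≡ {u} {v} u≢v c = cong (λ b → if b then ω u v else 0)
    (∧⁺ (not⁺ (u≢v ∘ isYes⁻ (u ≟ v))) (Equivalence.to Boolₚ.T-≡ (ℕₚ.≤⇒≤ᵇ c)))

  Ω-insert : ∀ {U X a t} → a ∉ U → a ∈ X → U ⊆ X → Ω U t + ω̂ t a ≤ Ω X t
  Ω-insert {U} {X} {a} {t} a∉U a∈X U⊆X = ℕₚ.≤-trans (ℕₚ.+-monoʳ-≤ (Ω U t) (Ω-⁅⁆ t a))
    (ℕₚ.≤-trans (Ω-∪ (λ xU x≡a → a∉U (subst (_∈ U) (⁅⁆⁻ x≡a) xU)) t)
      (Ω-mono (λ h → [ U⊆X , (λ x≡a → subst (_∈ X) (sym (⁅⁆⁻ x≡a)) a∈X) ]′ (∪⁻ h)) t))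

  -- One side of a piece X with terminals t, t′ cut by a: the components of G - {t,a} meeting both
  -- t and a and avoiding t′.
  module Side {m} (solved : Solved m) {X t t′} (P : Piece X t t′) (X≤ : countV X ≤ suc m) {a} (a∈X : a ∈ X)
    (sep : ∀ {x y} → G t x ≡ true → Path G (X ∖ a) x y → ¬ G y t′ ≡ true) where

    open Piece P

    private
      S = (allV ∖ t) ∖ a

      S-in : ∀ {x} → x ≢ t → x ≢ a → x ∈ S
      S-in x≢t x≢a = ∖⁺ (∖⁺ ∈allV x≢t) x≢a

      X∖a⊆S : (X ∖ a) ⊆ S
      X∖a⊆S h = S-in (λ { refl → u∉X (∖⊆ h) }) (proj₂ (∖⁻ h))

      t′≢a : t′ ≢ a
      t′≢a refl = v∉X a∈X

      t′∈S : t′ ∈ S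
      t′∈S = S-in (u≢v ∘ sym) t′≢a

    a-to-t′ : ∃ λ z → G a z ≡ true × Path G S z t′
    a-to-t′ with meets-v
    ... | x , xX , e with last-visit (widen (λ h → ∖⁺ {S = allV} {u = t} ∈allV λ { refl → u∉X h }) (connected a∈X xX)
                                      ++ edge (∖⁺ ∈allV λ { refl → u∉X xX }) (∖⁺ ∈allV (u≢v ∘ sym)) e)
    ...   | inj₁ a≡t′ = contradiction (sym a≡t′) t′≢a
    ...   | inj₂ r    = r

    sel : VSet n
    sel = bridge t a ∩ ∁ (conn G S t′)

    sel-t′ : ∀ {w} → w ∈ sel → ¬ Path G S w t′
    sel-t′ w∈ p = ∁⁻ (proj₂ (∩⁻ w∈)) (conn⁺ (reverse p))

    leave : ∀ {x y} → x ∈ X → y ∉ X → Path G S x y → ∃ λ p → Path G (X ∖ a) x p × G p t′ ≡ true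
    leave xX y∉X path with exit _ path xX y∉X
    ... | p , q , path′ , e , qS , q∉X with closed (proj₂ (∩⁻ (target∈ path′))) e
    ...   | inj₁ qX          = contradiction qX q∉X
    ...   | inj₂ (inj₁ refl) = contradiction refl (proj₂ (∖⁻ {S = allV} (∖⊆ qS)))
    ...   | inj₂ (inj₂ refl) = p , widen (λ h → let hS , hX = ∩⁻ h in ∖⁺ hX (proj₂ (∖⁻ hS))) path′ , e

    -- The component touches `a`, so it has a vertex in `X`; the only exits from `X` are `t` and
    -- `t′`, and it contains neither.
    sel⊆X : ∀ {w x} → w ∈ sel → Path G S w x → x ∈ X
    sel⊆X {w} {x} w∈ p with touches⁻ (proj₂ (proj₂ (bridge⁻ (proj₁ (∩⁻ w∈)))))
    ... | y , q , e with closed a∈X (G-sym e)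
    ...   | inj₂ (inj₁ refl) = contradiction refl (proj₂ (∖⁻ {S = allV} (∖⊆ (target∈ q))))
    ...   | inj₂ (inj₂ refl) = contradiction q (sel-t′ w∈)
    ...   | inj₁ yX with x ∈? X
    ...     | yes xX = xX
    ...     | no x∉X with leave yX x∉X (reverse q ++ p)
    ...       | z , path , e′ = contradiction
                  (q ++ (widen X∖a⊆S path ++ edge (X∖a⊆S (target∈ path)) t′∈S e′)) (sel-t′ w∈)

    a-out : ∀ {Q} → a ∈ Q → (∀ {x} → Path G S x t′ → x ∈ Q) → ∁ X ⊆ Q → Path G Q a r₀
    a-out aQ h ∁X⊆Q = let _ , e , p = a-to-t′ in cons aQ e (restrict h p ++ widen ∁X⊆Q out-v)

    out-a : ∀ {w} → w ∈ sel → Path G (∁ (conn G S w)) a r₀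
    out-a w∈ = a-out (∁⁺ λ h → u∉∖u (target∈ (conn⁻ h)))
      (λ p → ∁⁺ λ h → sel-t′ w∈ (conn⁻ h ++ p))
      (λ h → ∁⁺ λ h′ → ∁⁻ h (sel⊆X w∈ (conn⁻ h′)))

    open Bundle solved u∉X a∈X X≤ sel (proj₁ ∘ ∩⁻) sel⊆X out-u out-a public
      using (U; U⁻; U⁺; U⊆X; U⊆S; U-closed; a∉U; t≢a; U∩pend; split-sol; linked-sol)

    U-t′ : ∀ {x} → x ∈ U → ¬ Path G S x t′
    U-t′ xU p = let _ , w∈ , q = U⁻ xU in sel-t′ w∈ (q ++ p)

    -- Every vertex of the walk from `a` to `t′` reaches `t′` without `t` and `a`, so `y` is not on
    -- it; from `t′` on, the walk to r₀ runs outside `X`.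
    escape : ∀ {y} → y ∈ X → y ≢ a → ¬ Path G S y t′ → Path G (allV ∖ y) a r₀
    escape yX y≢a ¬p = a-out (∖⁺ ∈allV (y≢a ∘ sym)) (λ p → ∖⁺ ∈allV λ { refl → ¬p p })
      (λ h → ∖⁺ ∈allV λ { refl → ∁⁻ h yX })

    -- The component of `t′` in G - {t,a} is one bridge more: it meets `a` through `X`, and `t`
    -- along the walks via r₀ outside `X`.
    count< : countV sel < cF G t a
    count< rewrite cF≡ t a with a-to-t′ | last-visit (out-u ++ reverse out-v)
    ... | _           | inj₁ t≡t′          = contradiction t≡t′ u≢v
    ... | z , az , z→t′ | inj₂ (z′ , tz′ , q) with find-bridge {t} {a}
            (reverse (widen (λ h → S-in (proj₂ (∖⁻ h)) λ { refl → ∁⁻ (∖⊆ h) a∈X }) q)) (G-sym tz′)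
            (reverse z→t′) (G-sym az)
    ...   | w , w∈ , p = countV-mono-< (proj₁ ∘ ∩⁻) (λ h → sel-t′ h p) w∈

    -- The component of `x` meets `t` by assumption and `a` because `X` is connected. If it
    -- contained `t′`, the part of the walk up to its exit from `X` would contradict `sep`.
    side : ∀ {x y} → x ∈ X → x ≢ a → Path G (X ∖ a) x y → G y t ≡ true → x ∈ U
    side {x} xX x≢a p e with to-a connected a∈X xX x≢a
    ... | z , q , e′ with find-bridge {t} {a} (widen X∖a⊆S p) e (widen X∖a⊆S q) e′
    ...   | w , w∈ , path = U⁺ (∩⁺ w∈ (∁⁺ λ h → no-t′ (reverse path ++ reverse (conn⁻ h)))) path
      where
      no-t′ : ¬ Path G S x t′
      no-t′ r with leave xX v∉X r
      ... | z , r′ , e″ = sep (G-sym e) (reverse p ++ r′) e″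

    t-a : countV sel ≡ 0 → G t a ≡ true
    t-a eq with meets-u
    ... | x , xX , e with x ≟ a
    ...   | yes refl = G-sym e
    ...   | no x≢a = contradiction (sym eq) (ℕₚ.<⇒≢
              (countV-some (proj₁ (proj₂ (U⁻ (side xX x≢a (nil (∖⁺ xX x≢a)) e))))))

    -- If at least two components are selected, `count<` makes {t,a} a nontrivial 2-cut, and the two
    -- values of ω add up to c(G, ta) - 2, which is at least the number selected minus one.
    -- Otherwise the default 0 is enough.
    budget : countV sel ≤ suc (ω̂ t a + ω̂ a t)
    budget with countV sel ≤? 1
    ... | yes le = ℕₚ.≤-trans le (s≤s z≤n)
    ... | no ¬le = s≤s⁻¹ (ℕₚ.≤-trans count< (ℕₚ.≤-reflexive (sym (begin
        2 + (ω̂ t a + ω̂ a t)  ≡⟨ cong (2 +_) (cong₂ _+_ (ω̂≡ t≢a three) (ω̂≡ (t≢a ∘ sym) (subst (3 ≤_) (cF-sym t a) three))) ⟩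
        2 + (ω t a + ω a t)  ≡⟨ ℕₚ.+-comm 2 _ ⟩
        ω t a + ω a t + 2    ≡⟨ ω-split t a (t≢a , three) ⟩
        cF G t a             ∎))))
      where
      open ≡-Reasoning
      three : 3 ≤ cF G t a
      three = ℕₚ.≤-trans (s≤s (ℕₚ.≰⇒> ¬le)) count<

    -- The unit beyond ω goes to `a`, which has one to spare for each side; `t` pays only ω.
    half-split : Sol U t a (ω̂ t a) (suc (ω̂ a t)) ⊥ ⊥
    half-split = weaken-sol ℕₚ.≤-refl ℕₚ.≤-refl id (λ ())
      (split-sol (ℕₚ.≤-trans budget (ℕₚ.≤-reflexive (sym (ℕₚ.+-suc _ _)))))

    half-linked : Sol U t a (suc (ω̂ t a)) (suc (ω̂ a t)) ⊤ ⊥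
    half-linked = weaken-sol ℕₚ.≤-refl ℕₚ.≤-refl id (λ ()) (linked-sol budget t-a)

  module Series {m} (solved : Solved m) {X u v} (P : Piece X u v) (X≤ : countV X ≤ suc m) {a} (a∈X : a ∈ X)
    (sep : ∀ {x y} → G u x ≡ true → Path G (X ∖ a) x y → ¬ G y v ≡ true)
    (pendant : Pendant (pend a) a (pendants a)) where

    open Piece P

    private
      sep′ : ∀ {x y} → G v x ≡ true → Path G (X ∖ a) x y → ¬ G y u ≡ true
      sep′ vx p yu = sep (G-sym yu) (reverse p) (G-sym vx)

    module A = Side solved P X≤ a∈X sep
    module B = Side solved (swap-piece P) X≤ a∈X sep′
    module W = Pendant pendant
    module HB = Sol B.half-linked

    private
      u≢a : u ≢ a
      u≢a = A.t≢a

      v≢a : v ≢ a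
      v≢a = B.t≢a

      u∉pend : u ∉ pend a
      u∉pend h = proj₂ (behind⁻ h) (reverse (widen (λ h → ∖⁺ ∈allV λ { refl → ∁⁻ h a∈X }) out-u))

      v∉pend : v ∉ pend a
      v∉pend h = proj₂ (behind⁻ h) (reverse (widen (λ h → ∖⁺ ∈allV λ { refl → ∁⁻ h a∈X }) out-v))

      -- A vertex of `B.U` walks to a neighbour of `v` inside `X` and without `a`, so it reaches `v`
      -- in G - {u,a}; no vertex of `A.U` does.
      A∩B : Disjoint A.U B.U
      A∩B {x} xA xB with B.U⁻ xB
      ... | w , w∈ , p with touches⁻ (proj₁ (proj₂ (bridge⁻ (proj₁ (∩⁻ w∈)))))
      ...   | y , q , e = A.U-t′ xA (path ++ edge (target∈ path) (∖⁺ (∖⁺ ∈allV (u≢v ∘ sym)) v≢a) e)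
        where
        path : Path G ((allV ∖ u) ∖ a) x y
        path = restrict (λ r → ∖⁺ (∖⁺ ∈allV λ { refl → u∉X (B.sel⊆X w∈ (q ++ reverse r)) })
                                  (proj₂ (∖⁻ (source∈ r)))) (reverse p ++ q)

      -- A vertex not behind `a` reaches r₀ without `a`, and it must first leave `X` at `u` or at
      -- `v`.
      covered : ∀ {x} → x ∈ X → x ≢ a → x ∈ A.U ⊎ x ∈ B.U ⊎ x ∈ pend a
      covered xX x≢a with behind? r₀ x≢a
      ... | inj₁ h = inj₂ (inj₂ h)
      ... | inj₂ p with exit X (reverse p) xX (∁⁻ (target∈ out-u))
      ...   | z , q , path , e , _ , q∉X with closed (proj₂ (∩⁻ (target∈ path))) e
                 | widen {S′ = X ∖ a} (λ h → let h₁ , h₂ = ∩⁻ h in ∖⁺ h₂ (proj₂ (∖⁻ h₁))) path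
      ...     | inj₁ qX          | _     = contradiction qX q∉X
      ...     | inj₂ (inj₁ refl) | path′ = inj₁ (A.side xX x≢a path′ e)
      ...     | inj₂ (inj₂ refl) | path′ = inj₂ (inj₁ (B.side xX x≢a path′ e))

      pend⊆X : pend a ⊆ X
      pend⊆X = pend⊆piece P a∈X

      -- An edge r i s i of X lies in one of the three parts: s i ≡ a is impossible, since a reaches
      -- r₀ avoiding any other vertex of X.
      classify : ∀ {i} → r i ∈ X → s i ∈ X → ((r i ∈ A.U × s i ∈ A.U) ⊎ (r i ∈ B.U × s i ∈ B.U)) ⊎ s i ∈ pend a
      classify {i} ri si with s i ≟ a
      ... | yes refl = contradiction (reverse escape) (proj₂ (behind⁻ (s∈behind i)))
        where
        r≢s : r i ≢ s i
        r≢s eq = G-irrefl (subst (λ z → G z (s i) ≡ true) eq (rs-edge i))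

        escape : Path G (allV ∖ r i) (s i) r₀
        escape with covered ri r≢s
        ... | inj₁ rA        = A.escape ri r≢s (A.U-t′ rA)
        ... | inj₂ (inj₁ rB) = B.escape ri r≢s (B.U-t′ rB)
        ... | inj₂ (inj₂ rW) = A.escape ri r≢s λ p → proj₂ (behind⁻ rW) (reverse
                (widen (λ h → ∖⁺ ∈allV (proj₂ (∖⁻ h))) p ++
                 widen (λ h → ∖⁺ ∈allV λ { refl → ∁⁻ h a∈X }) out-v))
      ... | no s≢a with covered si s≢a
      ...   | inj₂ (inj₂ sW) = inj₂ sW
      ...   | inj₁ sA = inj₁ (inj₁ (A.U-closed sA (G-sym (rs-edge i))
                (∖⁺ (∖⁺ ∈allV λ { refl → u∉X ri }) λ r≡a → A.U∩pend sA (subst (λ z → s i ∈ pend z) r≡a (s∈behind i))) , sA))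
      ...   | inj₂ (inj₁ sB) = inj₁ (inj₂ (B.U-closed sB (G-sym (rs-edge i))
                (∖⁺ (∖⁺ ∈allV λ { refl → v∉X ri }) λ r≡a → B.U∩pend sB (subst (λ z → s i ∈ pend z) r≡a (s∈behind i))) , sB))

    module _ {e L} (half : Sol A.U u a (e + ω̂ u a) (suc (ω̂ a u)) L ⊥) where

      private
        module HA = Sol half

        H = (HA.graph ⊔ HB.graph) ⊔ W.graph

        all = join (join HA.local HB.local
            (λ { xA (inj₁ xB) → A∩B xA xB ; xA (inj₂ (inj₁ refl)) → v∉X (A.U⊆X xA) ; xA (inj₂ (inj₂ refl)) → A.a∉U xA })
            (λ { xB (inj₁ xA) → A∩B xA xB ; xB (inj₂ (inj₁ refl)) → u∉X (B.U⊆X xB) ; xB (inj₂ (inj₂ refl)) → B.a∉U xB }))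
          W.local
          (λ x∈ → λ { (inj₁ xW) → [ (λ xA → A.U∩pend xA xW) , (λ xB → B.U∩pend xB xW) ]′ (∪⁻ x∈)
                    ; (inj₂ refl) → [ A.a∉U , B.a∉U ]′ (∪⁻ x∈) })
          (λ { xW (inj₁ (inj₁ xA)) → A.U∩pend xA xW ; xW (inj₁ (inj₂ (inj₁ refl))) → u∉pend xW
             ; xW (inj₁ (inj₂ (inj₂ refl))) → a∉pend xW
             ; xW (inj₂ (inj₁ xB)) → B.U∩pend xB xW ; xW (inj₂ (inj₂ (inj₁ refl))) → v∉pend xW
             ; xW (inj₂ (inj₂ (inj₂ refl))) → a∉pend xW })

        B-u : ∀ {y} → HB.graph u y ≢ true
        B-u h with supp HB.local h
        ... | inj₁ uB        = u∉X (B.U⊆X uB)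
        ... | inj₂ (inj₁ eq) = u≢v eq
        ... | inj₂ (inj₂ eq) = u≢a eq

        A-v : ∀ {y} → HA.graph v y ≢ true
        A-v h with supp HA.local h
        ... | inj₁ vA        = v∉X (A.U⊆X vA)
        ... | inj₂ (inj₁ eq) = u≢v (sym eq)
        ... | inj₂ (inj₂ eq) = v≢a eq

        W-u : ∀ {y} → W.graph u y ≢ true
        W-u h = [ u∉pend , u≢a ]′ (supp W.local h)

        W-v : ∀ {y} → W.graph v y ≢ true
        W-v h = [ v∉pend , v≢a ]′ (supp W.local h)

        -- As `a` lies in `X` but not in `U`, the value for {t,a} is part of `Ω X t` in addition to
        -- `Ω U t`.
        insert : ∀ {U t} e → a ∉ U → U ⊆ X → (e + ω̂ t a) + Ω U t ≤ e + Ω X t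
        insert {U} {t} e a∉U U⊆X = begin
          (e + ω̂ t a) + Ω U t  ≡⟨ rearrange e (ω̂ t a) (Ω U t) ⟩
          e + (Ω U t + ω̂ t a)  ≤⟨ ℕₚ.+-monoʳ-≤ e (Ω-insert a∉U a∈X U⊆X) ⟩
          e + Ω X t            ∎
          where
          open ℕₚ.≤-Reasoning
          rearrange : ∀ a b c → (a + b) + c ≡ a + (c + b)
          rearrange = solve-∀

        -- The terminals lie outside the three parts, so the values of ω at `a` for {a,u} and {a,v}
        -- come on top of `Ω` of the parts. The two units for the sides are the `+ 1` of the
        -- hypothesis and the component of r₀ in `pendants<`.
        deg-a : deg H a ≤ f a
        deg-a = begin
            deg H a
              ≤⟨ deg-join disj (deg-join A∩B HA.deg-v HB.deg-v) W.deg-a ⟩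
            (suc (ω̂ a u) + suc (ω̂ a v) + pendants a) + Ω ((A.U ∪ B.U) ∪ pend a) a
              ≡⟨ rearrange (ω̂ a u) (ω̂ a v) (pendants a) (Ω ((A.U ∪ B.U) ∪ pend a) a) ⟩
            (Ω ((A.U ∪ B.U) ∪ pend a) a + ω̂ a u + ω̂ a v) + suc (pendants a) + 1
              ≤⟨ ℕₚ.+-monoˡ-≤ 1 (ℕₚ.+-mono-≤ (ℕₚ.≤-trans
                   (ℕₚ.+-monoˡ-≤ (ω̂ a v) (Ω-insert {X = ((A.U ∪ B.U) ∪ pend a) ∪ ⁅ u ⁆} (u∉X ∘ parts⊆X) (∪⁺ʳ ⁅⁆⁺) ∪⁺ˡ))
                   (ℕₚ.≤-trans (Ω-insert {X = allV}
                     (λ h → [ v∉X ∘ parts⊆X , u≢v ∘ sym ∘ ⁅⁆⁻ ]′ (∪⁻ h)) ∈allV (λ _ → ∈allV))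
                     (ℕₚ.≤-reflexive (Ω-all a))))
                   (pendants< λ { refl → ∁⁻ (target∈ out-u) a∈X })) ⟩
            sumω G ω a + ncomp G (allV ∖ a) + 1
              ≤⟨ ω-sum a ⟩
            f a ∎
          where
          open ℕₚ.≤-Reasoning
          disj : Disjoint (A.U ∪ B.U) (pend a)
          disj h hW = [ (λ xA → A.U∩pend xA hW) , (λ xB → B.U∩pend xB hW) ]′ (∪⁻ h)

          parts⊆X : ((A.U ∪ B.U) ∪ pend a) ⊆ X
          parts⊆X h = [ (λ h → [ A.U⊆X , B.U⊆X ]′ (∪⁻ h)) , pend⊆X ]′ (∪⁻ h)

          rearrange : ∀ x y p o → (suc x + suc y + p) + o ≡ (o + x + y) + suc p + 1
          rearrange = solve-∀

        fromA : ∀ {x y} → Path HA.graph allV x y → Path H allV x y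
        fromA = gmap (λ e → ⊔⁺ˡ (⊔⁺ˡ e)) id

        fromB : ∀ {x y} → Path HB.graph allV x y → Path H allV x y
        fromB = gmap (λ e → ⊔⁺ˡ (⊔⁺ʳ e)) id

        a→v : Path H allV a v
        a→v = fromB (Components.reverse {G = HB.graph} (symm HB.local) (HB.linked tt))

      -- The side of `v` is always linked, so `a` and everything behind it are joined to `v`.
      -- Whether `u` is joined as well, and at what cost, depends only on the half chosen for its
      -- side.
      series-sol : Sol X u v e 1 L ⊤
      series-sol = record
        { graph = H
        ; local = record
          { sub = sub all ; symm = symm all
          ; supp = λ h → [ [ [ inj₁ ∘ A.U⊆X , [ inj₂ ∘ inj₁ , (λ { refl → inj₁ a∈X }) ]′ ]′
                           , [ inj₁ ∘ B.U⊆X , [ inj₂ ∘ inj₂ , (λ { refl → inj₁ a∈X }) ]′ ]′ ]′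
                         , [ inj₁ ∘ pend⊆X , (λ { refl → inj₁ a∈X }) ]′ ]′ (supp all h)
          ; degree = degree′
          ; inside = proj₂
          ; tight = λ (ri , si) → tight all (classify ri si)
          ; absent = λ (ri , si) → absent all (classify ri si) }
        ; deg-u = ℕₚ.≤-trans (deg-⊔ˡ _ _ u W-u) (ℕₚ.≤-trans (deg-⊔ˡ _ _ u B-u)
                    (ℕₚ.≤-trans HA.deg-u (insert e A.a∉U A.U⊆X)))
        ; deg-v = ℕₚ.≤-trans (deg-⊔ˡ _ _ v W-v) (ℕₚ.≤-trans (deg-⊔ʳ _ _ v A-v)
                    (ℕₚ.≤-trans HB.deg-u (insert 1 B.a∉U B.U⊆X)))
        ; joined = joined′
        ; linked = λ l → fromA (HA.linked l) ++ a→v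
        ; no-edge = λ _ → ⊔-false (⊔-false (Boolₚ.¬-not λ h → A-v (symm HA.local h)) (Boolₚ.¬-not B-u)) (Boolₚ.¬-not W-u) }
        where
        degree′ : ∀ {x} → x ∈ X → deg H x ≤ f x
        degree′ {x} xX with x ≟ a
        ... | yes refl = deg-a
        ... | no x≢a with covered xX x≢a
        ...   | inj₁ xA        = degree all (∪⁺ˡ (∪⁺ˡ xA))
        ...   | inj₂ (inj₁ xB) = degree all (∪⁺ˡ (∪⁺ʳ xB))
        ...   | inj₂ (inj₂ xW) = degree all (∪⁺ʳ xW)

        joined′ : ∀ {x} → x ∈ X → Path H allV x u ⊎ Path H allV x v
        joined′ {x} xX with x ≟ a
        ... | yes refl = inj₂ a→v
        ... | no x≢a with covered xX x≢a
        ...   | inj₁ xA = Sum.map fromA (λ p → fromA p ++ a→v) (HA.joined xA)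
        ...   | inj₂ (inj₁ xB) = inj₂ ([ fromB , (λ p → fromB p ++ a→v) ]′ (HB.joined xB))
        ...   | inj₂ (inj₂ xW) = inj₂ (gmap ⊔⁺ʳ id (W.joined xW) ++ a→v)

    solutions : Sol X u v 1 1 ⊤ ⊤ × Sol X u v 0 1 ⊥ ⊤
    solutions = series-sol {1} A.half-linked , series-sol {0} A.half-split

  module Component {m} (solved : Solved m) (solvedᵖ : Solvedᵖ m) {w x₀} (x₀∈ : x₀ ∈ pend w)
    (X≤ : countV (conn G (allV ∖ w) x₀) ≤ suc m) where

    private
      X : VSet n
      X = conn G (allV ∖ w) x₀

      i₀ = proj₁ (behind-block x₀∈)

      r≡w : r i₀ ≡ w
      r≡w = proj₁ (proj₂ (behind-block x₀∈))

      a : Fin n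
      a = s i₀

      a∈X : a ∈ X
      a∈X = conn⁺ (proj₂ (proj₂ (behind-block x₀∈)))

      wa : G w a ≡ true
      wa = subst (λ z → G z a ≡ true) r≡w (rs-edge i₀)

      w∉X : w ∉ X
      w∉X h = u∉∖u (target∈ (conn⁻ h))

      w≢a : w ≢ a
      w≢a eq = w∉X (subst (_∈ X) (sym eq) a∈X)

      connected : ∀ {x y} → x ∈ X → y ∈ X → Path G X x y
      connected = component-connected (allV ∖ w)

      closed : ∀ {x y} → x ∈ X → G x y ≡ true → y ∈ X ⊎ y ≡ w
      closed {y = y} x∈ e with y ≟ w
      ... | yes y≡w = inj₂ y≡w
      ... | no y≢w  = let p = conn⁻ x∈ in inj₁ (conn⁺ (p ++ edge (target∈ p) (∖⁺ ∈allV y≢w) e))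

      out : Path G (∁ X) w r₀
      out with last-visit {S = allV} (G-conn {w} {r₀})
      ... | inj₁ refl        = nil (∁⁺ w∉X)
      ... | inj₂ (z , e , p) = cons (∁⁺ w∉X) e (restrict
              (λ q → ∁⁺ λ h → proj₂ (behind⁻ x₀∈) (reverse (conn⁻ h ++ q))) p)

      a-out : ∀ {Q} → a ∈ Q → ∁ X ⊆ Q → Path G Q a r₀
      a-out aQ ⊆Q = cons aQ (G-sym wa) (widen ⊆Q out)

      sel⊆X : ∀ {v x} → v ∈ bridge w a → Path G ((allV ∖ w) ∖ a) v x → x ∈ X
      sel⊆X v∈ p with touches⁻ (proj₂ (proj₂ (bridge⁻ v∈)))
      ... | y , q , e with closed a∈X (G-sym e)
      ...   | inj₂ refl = contradiction refl (proj₂ (∖⁻ {S = allV} (∖⊆ (target∈ q))))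
      ...   | inj₁ yX   = conn⁺ (conn⁻ yX ++ widen ∖⊆ (reverse q ++ p))

      out-a : ∀ {v} → v ∈ bridge w a → Path G (∁ (conn G ((allV ∖ w) ∖ a) v)) a r₀
      out-a v∈ = a-out (∁⁺ λ h → u∉∖u (target∈ (conn⁻ h))) λ h → ∁⁺ λ h′ → ∁⁻ h (sel⊆X v∈ (conn⁻ h′))

      pend⊆X : pend a ⊆ X
      pend⊆X = behind⊆ a∈X λ qX p∉X e → case closed qX e of λ
        { (inj₁ pX) → contradiction pX p∉X ; (inj₂ refl) → out }

      pend≤ : countV (pend a) ≤ m
      pend≤ = countV-⊂ pend⊆X a∉pend a∈X X≤

      a≢r₀ : a ≢ r₀
      a≢r₀ eq = ∁⁻ (target∈ out) (subst (_∈ X) eq a∈X)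

      cF-wa : cF G w a ≡ cF G (r i₀) (s i₀)
      cF-wa = cong (λ z → cF G z a) (sym r≡w)

      p≤1 : countV (bridge w a) ≤ 1
      p≤1 = subst (_≤ 1) (trans (sym cF-wa) (cF≡ w a)) (cF≤1 i₀)

    module A = Bundle solved w∉X a∈X X≤ (bridge w a) id sel⊆X out out-a
    -- At most one bridge exists, so no unit beyond the link is needed: the bridge links `w` with
    -- `a` if there is one, and the edge does otherwise.
    module HA = Sol (A.linked-sol {0} {0} p≤1 (λ _ → wa))
    module W = Pendant (solvedᵖ a pend≤)

    private
      H = HA.graph ⊔ W.graph

      w∉pend : w ∉ pend a
      w∉pend h = w∉X (pend⊆X h)

      covered : ∀ {x} → x ∈ X → x ≢ a → x ∈ A.U ⊎ x ∈ pend a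
      covered xX x≢a with behind? r₀ x≢a
      ... | inj₁ h = inj₂ h
      ... | inj₂ p with exit X (reverse p) xX (∁⁻ (target∈ out))
      ...   | z , q , path , e , _ , q∉X with closed (proj₂ (∩⁻ (target∈ path))) e | to-a connected a∈X xX x≢a
      ...     | inj₁ qX   | _           = contradiction qX q∉X
      ...     | inj₂ refl | z′ , p′ , e′ with find-bridge {w} {a}
                (widen (λ h → let h₁ , h₂ = ∩⁻ h in A.S⁺ (λ { refl → w∉X h₂ }) (proj₂ (∖⁻ h₁))) path) e
                (widen (λ h → A.S⁺ (λ { refl → w∉X (∖⊆ h) }) (proj₂ (∖⁻ h))) p′) e′
      ...       | v , v∈ , v→x = inj₁ (A.U⁺ v∈ v→x)

      all = join HA.local W.local
        (λ { xA (inj₁ xW) → A.U∩pend xA xW ; xA (inj₂ refl) → A.a∉U xA })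
        (λ { xW (inj₁ xA) → A.U∩pend xA xW ; xW (inj₂ (inj₁ refl)) → w∉pend xW
           ; xW (inj₂ (inj₂ refl)) → a∉pend xW })

      W-w : ∀ {y} → W.graph w y ≢ true
      W-w h = [ w∉pend , w≢a ]′ (supp W.local h)

      -- Two mixed cases are impossible. If `s i` is `a` and `r i` lies in `X`, then `a` reaches r₀
      -- through `w` without `r i` and is not behind it. If `r i` is `w`, then `s-unique` forces
      -- `s i` to be `a`.
      classify : ∀ {i} → s i ∈ X → (s i ≡ a × r i ≡ w) ⊎ (r i ∈ A.U × s i ∈ A.U) ⊎ s i ∈ pend a
      classify {i} si with s i ≟ a | r i ≟ w
      ... | yes s≡a | yes ri≡w = inj₁ (s≡a , ri≡w)
      ... | yes s≡a | no r≢w = contradiction (reverse (subst (λ z → Path G (allV ∖ r i) z r₀) (sym s≡a)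
              (a-out (∖⁺ ∈allV a≢r) λ h → ∖⁺ ∈allV λ { refl → ∁⁻ h ri }))) (proj₂ (behind⁻ (s∈behind i)))
        where
        a≢r : a ≢ r i
        a≢r eq = G-irrefl (subst (λ z → G (r i) z ≡ true) (trans s≡a eq) (rs-edge i))

        ri : r i ∈ X
        ri = [ id , (λ eq → contradiction eq r≢w) ]′ (closed si (G-sym (rs-edge i)))
      ... | no s≢a | yes ri≡w = contradiction (s-unique (trans ri≡w (sym r≡w))
              (subst (λ z → Path G (allV ∖ z) (s i) a) (sym ri≡w) (reverse (conn⁻ si) ++ conn⁻ a∈X))) s≢a
      ... | no s≢a | no r≢w with covered si s≢a
      ...   | inj₂ sW = inj₂ (inj₂ sW)
      ...   | inj₁ sA = inj₂ (inj₁ (A.U-closed sA (G-sym (rs-edge i))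
                (A.S⁺ r≢w λ r≡a → A.U∩pend sA (subst (λ z → s i ∈ pend z) r≡a (s∈behind i))) , sA))

      -- Only one of the two spare units is spent, on the link to `w`; the other gives the strict
      -- bound.
      deg-a : suc (deg H a) ≤ f a
      deg-a = begin
          suc (deg H a)
            ≤⟨ s≤s (deg-join A.U∩pend HA.deg-v W.deg-a) ⟩
          suc (suc (pendants a) + Ω (A.U ∪ pend a) a)
            ≡⟨ rearrange (pendants a) (Ω (A.U ∪ pend a) a) ⟩
          Ω (A.U ∪ pend a) a + suc (pendants a) + 1
            ≤⟨ ℕₚ.+-monoˡ-≤ 1 (ℕₚ.+-mono-≤
                 (ℕₚ.≤-trans (Ω-mono (λ _ → ∈allV) a) (ℕₚ.≤-reflexive (Ω-all a))) (pendants< a≢r₀)) ⟩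
          sumω G ω a + ncomp G (allV ∖ a) + 1
            ≤⟨ ω-sum a ⟩
          f a ∎
        where
        open ℕₚ.≤-Reasoning
        rearrange : ∀ p o → suc (suc p + o) ≡ o + suc p + 1
        rearrange = solve-∀

      fromA : ∀ {x y} → Path HA.graph allV x y → Path H allV x y
      fromA = gmap (λ e → ⊔⁺ˡ e) id

      a→w : Path H allV a w
      a→w = fromA (Components.reverse {G = HA.graph} (symm HA.local) (HA.linked tt))

    component-sol : Pendant X w 1
    component-sol = record
      { graph = H
      ; local = record
        { sub = sub all ; symm = symm all
        ; supp = λ h → [ [ inj₁ ∘ A.U⊆X , [ inj₂ , (λ { refl → inj₁ a∈X }) ]′ ]′
                       , [ inj₁ ∘ pend⊆X , (λ { refl → inj₁ a∈X }) ]′ ]′ (supp all h)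
        ; degree = degree′
        ; inside = id
        ; tight = tight′
        ; absent = absent′ }
      ; deg-a = ℕₚ.≤-trans (deg-⊔ˡ _ _ w W-w) (ℕₚ.≤-trans HA.deg-u (ℕₚ.+-monoʳ-≤ 1 (Ω-mono A.U⊆X w)))
      ; joined = joined′ }
      where
      degree′ : ∀ {x} → x ∈ X → deg H x ≤ f x
      degree′ {x} xX with x ≟ a
      ... | yes refl = ℕₚ.<⇒≤ deg-a
      ... | no x≢a   = degree all ([ ∪⁺ˡ , ∪⁺ʳ ]′ (covered xX x≢a))

      tight′ : ∀ {i} → s i ∈ X → suc (deg H (s i)) ≤ f (s i)
      tight′ si with classify si
      ... | inj₁ (s≡a , _) = subst (λ z → suc (deg H z) ≤ f z) (sym s≡a) deg-a
      ... | inj₂ R         = tight all R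

      absent′ : ∀ {i} → s i ∈ X → cF G (r i) (s i) ≡ 1 → H (r i) (s i) ≡ false
      absent′ {i} si c with classify si
      ... | inj₂ R = absent all R c
      ... | inj₁ (s≡a , ri≡w) = subst₂ (λ y z → H y z ≡ false) (sym ri≡w) (sym s≡a)
              (⊔-false (HA.no-edge (ℕₚ.≤-reflexive (sym (trans (sym (cF≡ w a)) (subst₂ (λ y z → cF G y z ≡ 1) ri≡w s≡a c)))))
                       (Boolₚ.¬-not W-w))

      joined′ : ∀ {x} → x ∈ X → Path H allV x w
      joined′ {x} xX with x ≟ a
      ... | yes refl = a→w
      ... | no x≢a with covered xX x≢a
      ...   | inj₁ xA = [ fromA , (λ p → fromA p ++ a→w) ]′ (HA.joined xA)
      ...   | inj₂ xW = gmap (λ e → ⊔⁺ʳ e) id (W.joined xW) ++ a→w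

  fold-pendants : ∀ a → (∀ {x} → x ∈ pend a → Pendant (conn G (allV ∖ a) x) a 1) → Pendant (pend a) a (pendants a)
  fold-pendants a sols with fold-components (allV ∖ a) (λ p U → Pendant U a p)
      (isRep G (allV ∖ a) ∩ pend a) (proj₁ ∘ ∩⁻) no-pendant
      (λ {p} {U} w∈ U⊆S U∩C P → subst (Pendant _ a) (ℕₚ.+-comm p 1)
        (join-pendant (u∉∖u ∘ U⊆S) (u∉∖u ∘ target∈ ∘ conn⁻) U∩C P (sols (proj₂ (∩⁻ w∈)))))
  ... | U , P , U⁻ , U⁺ = weaken-pendant U⊆ ⊆U P
    where
    U⊆ : U ⊆ pend a
    U⊆ xU with U⁻ xU
    ... | w , w∈ , p = behind⁺ (proj₂ (∖⁻ (target∈ p)))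
          λ q → proj₂ (behind⁻ (proj₂ (∩⁻ w∈))) (q ++ reverse p)

    ⊆U : pend a ⊆ U
    ⊆U x∈ with behind⁻ x∈
    ... | x≢a , np with rep (allV ∖ a) (∖⁺ ∈allV x≢a)
    ...   | w , wr , p = U⁺ (∩⁺ wr (behind⁺ (proj₂ (∖⁻ (source∈ p))) λ q → np (q ++ p))) p

  component⊆pend : ∀ {a x} → x ∈ pend a → conn G (allV ∖ a) x ⊆ pend a
  component⊆pend x∈ h = let p = conn⁻ h in
    behind⁺ (proj₂ (∖⁻ (target∈ p))) λ q → proj₂ (behind⁻ x∈) (q ++ reverse p)

  -- The two claims need each other: a piece calls for the vertices behind its separator, and a
  -- component behind a vertex calls for a bridge. Each call omits the vertex `a` of the current set
  -- `X`, so it is smaller.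
  solve : ∀ m → Solved m × Solvedᵖ m
  solve zero = (λ c P → let _ , xX , _ = Piece.meets-u P in contradiction (ℕₚ.≤-trans (countV-some xX) c) λ ())
             , λ a c → fold-pendants a λ x∈ → contradiction (ℕₚ.≤-trans (countV-some x∈) c) λ ()
  solve (suc m) = two , λ a c → fold-pendants a λ x∈ →
      Component.component-sol solved solvedᵖ x∈ (ℕₚ.≤-trans (countV-mono (component⊆pend x∈)) c)
    where
    solved = proj₁ (solve m)
    solvedᵖ = proj₂ (solve m)

    two : Solved (suc m)
    two {X} {u} {v} X≤ P with Separator.separator G-sym X u v (Piece.u∉X P) (Piece.v∉X P) (Piece.u≢v P)
           (Piece.connected P) (Piece.out-u P ++ reverse (Piece.out-v P)) free
           (proj₁ (proj₂ (Piece.meets-u P))) (proj₂ (proj₂ (Piece.meets-u P)))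
           (proj₁ (proj₂ (Piece.meets-v P))) (proj₂ (proj₂ (Piece.meets-v P)))
    ... | a , a∈X , sep = Series.solutions solved P X≤ a∈X sep
            (solvedᵖ a (countV-⊂ (pend⊆piece P a∈X) a∉pend a∈X X≤))

  private
    in-scope : ∀ {x} → x ≢ r₀ → x ∈ pend r₀
    in-scope x≢r₀ = behind⁺ x≢r₀ (u∉∖u ∘ source∈)

    r≢s : ∀ i → r i ≢ s i
    r≢s i eq = G-irrefl (subst (λ z → G z (s i) ≡ true) eq (rs-edge i))

    s-in-scope : ∀ i → s i ∈ pend r₀
    s-in-scope i = in-scope λ eq → proj₂ (behind⁻ (s∈behind i))
      (subst (λ z → Path G (allV ∖ r i) z (s i)) eq (nil (∖⁺ ∈allV (r≢s i ∘ sym))))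

  spanning-tree : Σ (Adj n) λ T → IsSpanningTree G T × (∀ v → deg T v ≤ f v) × suc (deg T r₀) ≤ f r₀ ×
    (∀ i → suc (deg T (s i)) ≤ f (s i)) ×
    (∀ i → cF G (r i) (s i) ≡ 0 → T (r i) (s i) ≡ true) ×
    (∀ i → cF G (r i) (s i) ≡ 1 → T (r i) (s i) ≡ false)
  spanning-tree =
    T , (T-simple , (λ x y e → sub local (Tree.sub e)) , T-connected , acyclic (proj₂ pruned)) ,
    deg-T , deg-root , deg-s , forced , avoided
    where
    open Pendant (proj₂ (solve n) r₀ (countV≤n _)) renaming (graph to H)

    to-r₀ : ∀ {x} → Path H allV x r₀
    to-r₀ {x} with x ≟ r₀
    ... | yes refl = nil ∈allV
    ... | no x≢r₀  = joined (in-scope x≢r₀)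

    pruned : ∃ λ T → SpanningTreeOf H T all-pairs
    pruned = prune all-pairs (symm local) (to-r₀ ++ Components.reverse {G = H} (symm local) to-r₀)

    T : Adj n
    T = proj₁ pruned

    module Tree = SpanningTreeOf (proj₂ pruned)

    T-simple : Simple T
    T-simple = record
      { adj-sym = λ x y → case (T x y Boolₚ.≟ true) of λ
          { (yes e) → trans e (sym (Tree.symm e))
          ; (no ne) → trans (Boolₚ.¬-not ne) (sym (Boolₚ.¬-not (ne ∘ Tree.symm))) }
      ; adj-irrefl = λ x → Boolₚ.¬-not λ e → G-irrefl (sub local (Tree.sub e)) }

    T-connected : Connected T
    T-connected = Components.Path⇒Connected {G = T} Tree.symm allV {r₀} ∈allV λ _ _ → Tree.connected

    T≤H : ∀ v → deg T v ≤ deg H v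
    T≤H = deg-mono T H Tree.sub

    -- Every component of G - r₀ is behind r₀, so `pendants<` gives nothing here; the spare unit is
    -- the `+ 1` of the hypothesis, and r₀ has no link to pay for.
    deg-root : suc (deg T r₀) ≤ f r₀
    deg-root = begin
      suc (deg T r₀)                               ≤⟨ s≤s (ℕₚ.≤-trans (T≤H r₀) deg-a) ⟩
      suc (pendants r₀ + Ω (pend r₀) r₀)    ≤⟨ s≤s (ℕₚ.+-mono-≤ (pendants≤ r₀)
                                                        (ℕₚ.≤-trans (Ω-mono (λ _ → ∈allV) r₀) (ℕₚ.≤-reflexive (Ω-all r₀)))) ⟩
      suc (ncomp G (allV ∖ r₀) + sumω G ω r₀)      ≡⟨ rearrange (ncomp G (allV ∖ r₀)) (sumω G ω r₀) ⟩
      sumω G ω r₀ + ncomp G (allV ∖ r₀) + 1        ≤⟨ ω-sum r₀ ⟩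
      f r₀                                         ∎
      where
      open ℕₚ.≤-Reasoning
      rearrange : ∀ c o → suc (c + o) ≡ o + c + 1
      rearrange = solve-∀

    deg-T : ∀ v → deg T v ≤ f v
    deg-T v with v ≟ r₀
    ... | yes refl = ℕₚ.<⇒≤ deg-root
    ... | no v≢r₀  = ℕₚ.≤-trans (T≤H v) (degree local (in-scope v≢r₀))

    deg-s : ∀ i → suc (deg T (s i)) ≤ f (s i)
    deg-s i = ℕₚ.≤-trans (s≤s (T≤H (s i))) (tight local (s-in-scope i))

    avoided : ∀ i → cF G (r i) (s i) ≡ 1 → T (r i) (s i) ≡ false
    avoided i c = Boolₚ.¬-not λ e → false⇒∉ {S = H (r i)} (absent local (s-in-scope i) c) (mem (Tree.sub e))

    -- A path of T from r i to s i other than the edge itself has its interior in a bridge of {r i, s i}.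
    forced : ∀ i → cF G (r i) (s i) ≡ 0 → T (r i) (s i) ≡ true
    forced i c with T (r i) (s i) Boolₚ.≟ true
    ... | yes e = e
    ... | no ne with last-visit (Tree.connected {r i} {s i})
    ...   | inj₁ eq = contradiction eq (r≢s i)
    ...   | inj₂ (z , e , p) with last-visit (Components.reverse {G = T} Tree.symm p)
    ...     | inj₁ refl = contradiction e ne
    ...     | inj₂ (z′ , e′ , q) with find-bridge {r i} {s i} (gmap (λ h → sub local (Tree.sub h)) id q)
                (G-sym (sub local (Tree.sub e))) (nil (source∈ q)) (G-sym (sub local (Tree.sub e′)))
    ...       | w , w∈ , _ = contradiction (trans (sym c) (cF≡ (r i) (s i))) (ℕₚ.<⇒≢ (countV-some w∈))

theorem3p4 : (n : ℕ) (G : Adj n) → Simple G → 2 ≤ n → Connected G → K4MinorFree G →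
    (f : Fin n → ℕ) → (∀ v → 2 ≤ f v) →
    (ω : Fin n → Fin n → ℕ) →
    (∀ u v → NontrivialTwoCut G u v → ω u v + ω v u + 2 ≡ cF G u v) →
    (∀ u → sumω G ω u + ncomp G (allV ∖ u) + 1 ≤ f u) →
    (k : ℕ) (B : Fin (suc k) → VSet n) → IsBlockEnumeration G B →
    (r s : Fin (suc k) → Fin n) →
    (∀ i → G (r i) (s i) ≡ true) →
    (∀ i → B i (r i) ≡ true × B i (s i) ≡ true) →
    (∀ i → cF G (r i) (s i) ≤ 1) →
    (∀ i → i ≢ zero → IsRootVertex G B i (r i)) →
    Σ (Adj n) λ T →
    IsSpanningTree G T ×
    (∀ v → deg T v ≤ f v) ×
    suc (deg T (r zero)) ≤ f (r zero) ×
    (∀ i → suc (deg T (s i)) ≤ f (s i)) ×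
    (∀ i → cF G (r i) (s i) ≡ 0 → T (r i) (s i) ≡ true) ×
    (∀ i → cF G (r i) (s i) ≡ 1 → T (r i) (s i) ≡ false)
theorem3p4 n G simple _ connected free f _ ω ω-split ω-sum k B B-enum r s rs-edge rsB cF≤1 root =
  Construction.spanning-tree G-sym G-irrefl G-conn free f ω ω-split ω-sum r s (r zero) rs-edge cF≤1
    (Blocks.BlockTree.s∈behind G-sym G-conn B B-enum r s rs-edge r≢s rB sB root)
    (Blocks.BlockTree.behind-block G-sym G-conn B B-enum r s rs-edge r≢s rB sB root)
    (Blocks.BlockTree.s-unique G-sym G-conn B B-enum r s rs-edge r≢s rB sB root)
  where
  open Simple simple

  G-sym : ∀ {x y} → G x y ≡ true → G y x ≡ true
  G-sym {x} {y} e = trans (adj-sym y x) e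

  G-irrefl : ∀ {x} → G x x ≢ true
  G-irrefl {x} e with () ← trans (sym (adj-irrefl x)) e

  G-conn : ∀ {x y} → Path G allV x y
  G-conn = Components.Connected⇒Path G-sym allV connected ∈allV ∈allV

  r≢s : ∀ i → r i ≢ s i
  r≢s i eq = G-irrefl (subst (λ z → G z (s i) ≡ true) eq (rs-edge i))

  rB : ∀ i → r i ∈ B i
  rB i = mem (proj₁ (rsB i))

  sB : ∀ i → s i ∈ B i
  sB i = mem (proj₂ (rsB i))
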